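{- Let $X,Y$ be recursively presented Polish spaces. Then there is a recursive map $u^{X,Y}_r:(\omega^\omega)^2\to\omega^\omega$ such that for each $1\le\xi<\omega_1$, each $\gamma\in BC_\xi$ and each $\delta\in\omega^\omega$, $u^{X,Y}_r(\gamma,\delta)\in BC_\xi$. Moreover, for $x\in X$, if $\{\delta\}^{X,Y}(x)$ is defined, then $x\in\rho^X[u^{X,Y}_r(\gamma,\delta)]\Leftrightarrow\{\delta\}^{X,Y}(x)\in\rho^Y(\gamma)$.
   Context: Effective notions (recursively presented Polish spaces, recursive functions) are those of Moschovakis' book "Descriptive Set Theory". Each recursively presented Polish space $X$ has its standard effective enumeration $(N(X,k))_{k\in\omega}$ of a neighbourhood basis (possibly with empty sets; $N(X,0)=\emptyset$). $X$ is of type at most $1$ if it is a finite product of spaces equal to $\omega$, $\omega^\omega$ or $2^\omega$. $B\in\Sigma^0_1(X)$ iff $B=\bigcup_{i}N(X,\varepsilon(i))$ for some recursive $\varepsilon:\omega\to\omega$. A map $f:X\to Y$ is recursive if $\{(x,k)\mid f(x)\in N(Y,k)\}\in\Sigma^0_1(X\times\omega)$. Fix a good parametrization: sets $G^X\in\Sigma^0_1(\omega^\omega\times X)$, one for each recursively presented Polish $X$, such that $P\subseteq X$ is open iff $P=G^X_\gamma$ for some $\gamma\in\omega^\omega$, $P$ is $\Sigma^0_1$ iff $P=G^X_\gamma$ for some recursive $\gamma$, and for $X$ of type at most 1 and any $Y$ there is a recursive $S^{X,Y}:\omega^\omega\times X\to\omega^\omega$ with $(\gamma,x,y)\in G^{X\times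 Y}\Leftrightarrow(S^{X,Y}(\gamma,x),y)\in G^Y$. For $\gamma\in\omega^\omega$, $\{\gamma\}^{X,Y}$ is the partial function from $X$ to $Y$ with $\{\gamma\}^{X,Y}(x)$ defined and equal to $y$ iff $y$ is the (unique) point with $\forall k\,[y\in N(Y,k)\Leftrightarrow(\gamma,x,k)\in G^{X\times\omega}]$; write $\{\gamma\}$ when $Y=\omega^\omega$. Borel codes: let $\gamma^*(i):=\gamma(i+1)$. $BC_1:=\{\gamma\in\omega^\omega\mid\gamma(0)=0\}$ and for $2\le\xi<\omega_1$, $BC_\xi:=\{\gamma\in\omega^\omega\mid\gamma(0)=1$ and $\forall i\in\omega$, $\{\gamma^*\}(i)$ is defined and in $\bigcup_{1\le\eta<\xi}BC_\eta\}$; $BC:=\bigcup_{1\le\xi<\omega_1}BC_\xi$. For $\gamma\in BC$, $\rho^X(\gamma):=\bigcup_iN(X,\gamma^*(i))$ if $\gamma\in BC_1$, and $\rho^X(\gamma):=\bigcup_iX\setminus\rho^X(\{\gamma^*\}(i))$ otherwise. -}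

module Defs where

open import Level using (0ℓ)
open import Data.Nat.Base as ℕ using (ℕ; zero; suc; pred; _∸_; _≡ᵇ_; s≤s; z≤n)
import Data.Nat.Properties as ℕ
open import Data.Bool.Base using (Bool; true; false; if_then_else_)
import Data.Bool.Properties as Bool
open import Data.Integer.Base as ℤ using (+_; -[1+_])
import Data.Integer.Properties as ℤ
open import Data.Rational.Unnormalised.Base as ℚ using (ℚᵘ; mkℚᵘ; 0ℚᵘ; 1ℚᵘ; *<*; *≤*)
import Data.Rational.Unnormalised.Properties as ℚ
open import Data.Fin.Base using (Fin; zero; suc)
open import Data.Fin.Patterns using (0F; 1F; 2F; 3F; 4F)
open import Data.Vec.Base using (Vec; []; _∷_; head; tail; lookup; tabulate)
open import Data.Vec.Properties using (tabulate∘lookup)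
open import Data.Product.Base using (∃; _×_; _,_; proj₁; proj₂)
open import Data.Product.Relation.Binary.Pointwise.NonDependent using (×-setoid)
open import Data.Sum.Base using (_⊎_; inj₁; inj₂)
open import Data.Empty using (⊥-elim)
open import Function.Base using (_∘_; case_of_)
open import Function.Bundles using (_⇔_; mk⇔; Equivalence)
open import Relation.Nullary using (¬_; yes; no; contradiction)
open import Relation.Unary using (Pred; _≐_)
open import Relation.Binary.Bundles using (Setoid)
open import Relation.Binary.Definitions using (DecidableEquality)
open import Relation.Binary.PropositionalEquality
  using (_≡_; _≢_; refl; sym; trans; cong; cong₂; subst; subst₂; setoid; _→-setoid_)

-- The least class of total functions containing the zero, successor and
-- projection functions and closed under composition, primitive recursion and
-- minimisation of regular functions.  Closure is stated up to pointwise
-- equality, so no function extensionality is needed.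
data Recursive : ∀ {n} → (Vec ℕ n → ℕ) → Set where
  zeroᵣ : ∀ {n} → Recursive {n} (λ _ → 0)
  sucᵣ  : Recursive {1} (λ v → suc (head v))
  projᵣ : ∀ {n} (i : Fin n) → Recursive (λ v → lookup v i)
  compᵣ : ∀ {m n} {f : Vec ℕ n → ℕ} {g : Vec ℕ m → ℕ} {h : Fin m → Vec ℕ n → ℕ} →
          Recursive g → (∀ i → Recursive (h i)) →
          (∀ v → f v ≡ g (tabulate λ i → h i v)) →
          Recursive f
  primᵣ : ∀ {n} {f : Vec ℕ (suc n) → ℕ} {g : Vec ℕ n → ℕ} {h : Vec ℕ (suc (suc n)) → ℕ} →
          Recursive g → Recursive h →
          (∀ v → f (0 ∷ v) ≡ g v) →
          (∀ k v → f (suc k ∷ v) ≡ h (k ∷ f (k ∷ v) ∷ v)) →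
          Recursive f
  minᵣ  : ∀ {n} {f : Vec ℕ n → ℕ} {g : Vec ℕ (suc n) → ℕ} →
          Recursive g →
          (∀ v → g (f v ∷ v) ≡ 0) →
          (∀ v m → m ℕ.< f v → g (m ∷ v) ≢ 0) →
          Recursive f

RecursiveSeq : (ℕ → ℕ) → Set
RecursiveSeq f = Recursive {1} (f ∘ head)

record RecursiveRel {n} (R : Pred (Vec ℕ n) 0ℓ) : Set where
  field
    χ           : Vec ℕ n → ℕ
    χ-recursive : Recursive χ
    χ-spec      : ∀ v → (R v × χ v ≡ 1) ⊎ (¬ R v × χ v ≡ 0)

tri : ℕ → ℕ
tri zero    = 0
tri (suc n) = suc n ℕ.+ tri n

-- The largest w with tri w ≤ n.
root : ℕ → ℕ
root zero    = 0
root (suc n) = if suc n ≡ᵇ tri (suc (root n)) then suc (root n) else root n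

pair : ℕ → ℕ → ℕ
pair a b = tri (a ℕ.+ b) ℕ.+ b

π₁ π₂ : ℕ → ℕ
π₂ n = n ∸ tri (root n)
π₁ n = root n ∸ π₂ n

drop : ℕ → ℕ → ℕ
drop s zero    = s
drop s (suc n) = π₂ (drop s n)

-- The n-th entry (s)ₙ of the sequence coded by s; every finite sequence is an
-- initial part of a coded one, and (0)ₙ = 0.
entry : ℕ → ℕ → ℕ
entry s n = π₁ (drop s n)

tri-≥ : ∀ w → w ℕ.≤ tri w
tri-≥ zero    = z≤n
tri-≥ (suc w) = ℕ.m≤m+n (suc w) (tri w)

≡ᵇ-refl : ∀ n → (n ≡ᵇ n) ≡ true
≡ᵇ-refl zero    = refl
≡ᵇ-refl (suc n) = ≡ᵇ-refl n

≢⇒≡ᵇ-false : ∀ m n → m ≢ n → (m ≡ᵇ n) ≡ false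
≢⇒≡ᵇ-false zero    zero    m≢n = ⊥-elim (m≢n refl)
≢⇒≡ᵇ-false zero    (suc n) m≢n = refl
≢⇒≡ᵇ-false (suc m) zero    m≢n = refl
≢⇒≡ᵇ-false (suc m) (suc n) m≢n = ≢⇒≡ᵇ-false m n (m≢n ∘ cong suc)

root-yes : ∀ n → suc n ≡ tri (suc (root n)) → root (suc n) ≡ suc (root n)
root-yes n eq with suc n ≡ᵇ tri (suc (root n)) | trans (cong (suc n ≡ᵇ_) (sym eq)) (≡ᵇ-refl n)
... | true | _ = refl

root-no : ∀ n → suc n ≢ tri (suc (root n)) → root (suc n) ≡ root n
root-no n neq with suc n ≡ᵇ tri (suc (root n)) | ≢⇒≡ᵇ-false _ _ neq
... | false | _ = refl

root-tri : ∀ w b → b ℕ.≤ w → root (tri w ℕ.+ b) ≡ w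
root-tri zero    zero    _ = refl
root-tri (suc w) zero    _ = go
  where
  n = w ℕ.+ tri w ℕ.+ 0
  eq : n ≡ tri w ℕ.+ w
  eq = trans (ℕ.+-identityʳ _) (ℕ.+-comm w (tri w))
  r : root n ≡ w
  r = trans (cong root eq) (root-tri w w ℕ.≤-refl)
  go : root (suc n) ≡ suc w
  go = trans (root-yes n (trans (cong suc (ℕ.+-identityʳ _)) (cong (tri ∘ suc) (sym r))))
             (cong suc r)
root-tri w (suc b) b<w = go
  where
  n = tri w ℕ.+ b
  r : root n ≡ w
  r = root-tri w b (ℕ.<⇒≤ b<w)
  neq : suc n ≢ tri (suc (root n))
  neq eq = ℕ.<-irrefl (trans (ℕ.+-comm b (tri w)) (ℕ.suc-injective (trans eq (cong (tri ∘ suc) r))))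
                      (ℕ.+-monoˡ-< (tri w) b<w)
  go : root (tri w ℕ.+ suc b) ≡ w
  go = trans (cong root (ℕ.+-suc (tri w) b)) (trans (root-no n neq) r)

root-pair : ∀ a b → root (pair a b) ≡ a ℕ.+ b
root-pair a b = root-tri (a ℕ.+ b) b (ℕ.m≤n+m b a)

π₂-pair : ∀ a b → π₂ (pair a b) ≡ b
π₂-pair a b rewrite root-pair a b = ℕ.m+n∸m≡n (tri (a ℕ.+ b)) b

π₁-pair : ∀ a b → π₁ (pair a b) ≡ a
π₁-pair a b rewrite π₂-pair a b | root-pair a b = ℕ.m+n∸n≡m a b

drop-suc : ∀ s n → drop s (suc n) ≡ drop (π₂ s) n
drop-suc s zero    = refl
drop-suc s (suc n) = cong π₂ (drop-suc s n)

entry-pair-zero : ∀ a s → entry (pair a s) 0 ≡ a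
entry-pair-zero = π₁-pair

entry-pair-suc : ∀ a s n → entry (pair a s) (suc n) ≡ entry s n
entry-pair-suc a s n =
  cong π₁ (trans (drop-suc (pair a s) n) (cong (λ t → drop t n) (π₂-pair a s)))

root-suc-pos : ∀ n → 1 ℕ.≤ root (suc n)
root-suc-pos zero    = s≤s z≤n
root-suc-pos (suc n) with suc (suc n) ≡ᵇ tri (suc (root (suc n)))
... | true  = s≤s z≤n
... | false = root-suc-pos n

π₂-≤-pred : ∀ n → π₂ n ℕ.≤ pred n
π₂-≤-pred zero    = z≤n
π₂-≤-pred (suc n) =
  ℕ.∸-monoʳ-≤ (suc n) (ℕ.≤-trans (root-suc-pos n) (tri-≥ (root (suc n))))

entry-≥ : ∀ s n → s ℕ.≤ n → entry s n ≡ 0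
entry-≥ zero    zero    _   = refl
entry-≥ s       (suc n) s≤n =
  trans (cong π₁ (drop-suc s n))
        (entry-≥ (π₂ s) n (ℕ.≤-trans (π₂-≤-pred s) (ℕ.pred-mono-≤ s≤n)))

encode : (ℕ → ℕ) → ℕ → ℕ
encode x zero    = 0
encode x (suc n) = pair (x 0) (encode (x ∘ suc) n)

entry-encode : ∀ x n i → i ℕ.< n → entry (encode x n) i ≡ x i
entry-encode x (suc n) zero    _         = entry-pair-zero (x 0) (encode (x ∘ suc) n)
entry-encode x (suc n) (suc i) (s≤s i<n) =
  trans (entry-pair-suc (x 0) (encode (x ∘ suc) n) i) (entry-encode (x ∘ suc) n i i<n)


ext : ∀ {n} {f g : Vec ℕ n → ℕ} → Recursive g → (∀ v → f v ≡ g v) → Recursive f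
ext {g = g} rg eq =
  compᵣ rg projᵣ (λ v → trans (eq v) (cong g (sym (tabulate∘lookup v))))

module _ {n} {g : Vec ℕ n → ℕ} where
  ap₁ : ∀ (f : ℕ → ℕ) → RecursiveSeq f → Recursive g → Recursive (λ v → f (g v))
  ap₁ f rf rg = compᵣ {h = λ _ → g} rf (λ _ → rg) (λ _ → refl)

module _ {n} {g h : Vec ℕ n → ℕ} where
  ap₂ : ∀ (f : ℕ → ℕ → ℕ) → Recursive {2} (λ v → f (lookup v 0F) (lookup v 1F)) →
        Recursive g → Recursive h → Recursive (λ v → f (g v) (h v))
  ap₂ f rf rg rh =
    compᵣ {h = λ { zero → g ; (suc _) → h }} rf (λ { zero → rg ; (suc _) → rh }) (λ _ → refl)

pattern p0 = projᵣ 0F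
pattern p1 = projᵣ 1F
pattern p2 = projᵣ 2F
pattern p3 = projᵣ 3F

module _ {n} {g : Vec ℕ n → ℕ} (rg : Recursive g) where
  sᵣ : Recursive (λ v → suc (g v))
  sᵣ = ap₁ suc sucᵣ rg

  predᵣ : Recursive (λ v → pred (g v))
  predᵣ = ap₁ pred (primᵣ {g = λ _ → 0} {h = λ w → lookup w 0F} zeroᵣ p0 (λ _ → refl) (λ _ _ → refl)) rg

module _ {n} {g h : Vec ℕ n → ℕ} (rg : Recursive g) (rh : Recursive h) where
  +ᵣ : Recursive (λ v → g v ℕ.+ h v)
  +ᵣ = ap₂ ℕ._+_ (primᵣ {h = λ w → suc (lookup w 1F)} p0 (sᵣ p1) (λ _ → refl) (λ _ _ → refl)) rg rh

module _ {n} {g h : Vec ℕ n → ℕ} (rg : Recursive g) (rh : Recursive h) where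
  *ᵣ : Recursive (λ v → g v ℕ.* h v)
  *ᵣ = ap₂ ℕ._*_ (primᵣ {g = λ _ → 0} {h = λ w → lookup w 2F ℕ.+ lookup w 1F}
                         zeroᵣ (+ᵣ p2 p1) (λ _ → refl) (λ _ _ → refl)) rg rh

  ∸ᵣ : Recursive (λ v → g v ∸ h v)
  ∸ᵣ = ap₂ (λ k m → m ∸ k)
           (primᵣ {h = λ w → pred (lookup w 1F)} p0 (predᵣ p1) (λ _ → refl)
                  (λ k v → sym (ℕ.pred[m∸n]≡m∸[1+n] (lookup v 0F) k)))
           rh rg

oneᵣ : ∀ {n} → Recursive {n} (λ _ → 1)
oneᵣ = sᵣ zeroᵣ

triᵣ : ∀ {n} {g : Vec ℕ n → ℕ} → Recursive g → Recursive (λ v → tri (g v))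
triᵣ = ap₁ tri (primᵣ {g = λ _ → 0} {h = λ w → suc (lookup w 0F) ℕ.+ lookup w 1F}
                      zeroᵣ (+ᵣ (sᵣ p0) p1) (λ _ → refl) (λ _ _ → refl))

open RecursiveRel using (χ; χ-recursive; χ-spec)

module _ {n} {R S : Pred (Vec ℕ n) 0ℓ} (r : RecursiveRel R) (s : RecursiveRel S) where
  ∧ᵣ : RecursiveRel (λ v → R v × S v)
  ∧ᵣ .χ v = χ r v ℕ.* χ s v
  ∧ᵣ .χ-recursive = *ᵣ (χ-recursive r) (χ-recursive s)
  ∧ᵣ .χ-spec v with χ-spec r v | χ-spec s v
  ... | inj₁ (Rv , e) | inj₁ (Sv , e') = inj₁ ((Rv , Sv) , cong₂ ℕ._*_ e e')
  ... | inj₁ (_ , _) | inj₂ (¬Sv , e') =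
    inj₂ (¬Sv ∘ proj₂ , trans (cong (χ r v ℕ.*_) e') (ℕ.*-zeroʳ (χ r v)))
  ... | inj₂ (¬Rv , e) | _ = inj₂ (¬Rv ∘ proj₁ , cong (ℕ._* χ s v) e)

  →ᵣ : RecursiveRel (λ v → R v → S v)
  →ᵣ .χ v = 1 ∸ (χ r v ∸ χ s v)
  →ᵣ .χ-recursive = ∸ᵣ oneᵣ (∸ᵣ (χ-recursive r) (χ-recursive s))
  →ᵣ .χ-spec v with χ-spec r v | χ-spec s v
  ... | inj₁ (Rv , e) | inj₁ (Sv , e') = inj₁ ((λ _ → Sv) , cong₂ (λ a b → 1 ∸ (a ∸ b)) e e')
  ... | inj₁ (Rv , e) | inj₂ (¬Sv , e') = inj₂ ((λ f → ¬Sv (f Rv)) , cong₂ (λ a b → 1 ∸ (a ∸ b)) e e')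
  ... | inj₂ (¬Rv , e) | inj₁ (Sv , e') = inj₁ ((λ _ → Sv) , cong₂ (λ a b → 1 ∸ (a ∸ b)) e e')
  ... | inj₂ (¬Rv , e) | inj₂ (¬Sv , e') = inj₁ ((⊥-elim ∘ ¬Rv) , cong₂ (λ a b → 1 ∸ (a ∸ b)) e e')

module _ {n} {R S : Pred (Vec ℕ n) 0ℓ} where
  iffᵣ : RecursiveRel R → (∀ v → S v → R v) → (∀ v → R v → S v) → RecursiveRel S
  iffᵣ r f g .χ = χ r
  iffᵣ r f g .χ-recursive = χ-recursive r
  iffᵣ r f g .χ-spec v with χ-spec r v
  ... | inj₁ (Rv , e)  = inj₁ (g v Rv , e)
  ... | inj₂ (¬Rv , e) = inj₂ (¬Rv ∘ f v , e)

module _ {n} {f g : Vec ℕ n → ℕ} (rf : Recursive f) (rg : Recursive g) where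
  ≤ᵣ : RecursiveRel (λ v → f v ℕ.≤ g v)
  ≤ᵣ .χ v = 1 ∸ (f v ∸ g v)
  ≤ᵣ .χ-recursive = ∸ᵣ oneᵣ (∸ᵣ rf rg)
  ≤ᵣ .χ-spec v with f v ℕ.≤? g v
  ... | yes le = inj₁ (le , cong (1 ∸_) (ℕ.m≤n⇒m∸n≡0 le))
  ... | no nle with f v ∸ g v | ℕ.m<n⇒0<n∸m (ℕ.≰⇒> nle)
  ...   | suc d | _ = inj₂ (nle , ℕ.0∸n≡0 d)

≡ᵣ : ∀ {n} {f g : Vec ℕ n → ℕ} → Recursive f → Recursive g → RecursiveRel (λ v → f v ≡ g v)
≡ᵣ rf rg = iffᵣ (∧ᵣ (≤ᵣ rf rg) (≤ᵣ rg rf))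
                (λ _ e → ℕ.≤-reflexive e , ℕ.≤-reflexive (sym e))
                (λ _ (a , b) → ℕ.≤-antisym a b)

substᵣ : ∀ {m n} {R : Pred (Vec ℕ m) 0ℓ} {h : Fin m → Vec ℕ n → ℕ} →
         RecursiveRel R → (∀ i → Recursive (h i)) →
         RecursiveRel (λ v → R (tabulate λ i → h i v))
substᵣ {h = h} r rh .χ v = χ r (tabulate λ i → h i v)
substᵣ r rh .χ-recursive = compᵣ (χ-recursive r) rh (λ _ → refl)
substᵣ {h = h} r rh .χ-spec v = χ-spec r (tabulate λ i → h i v)

module _ {n} {R : Pred (Vec ℕ (suc n)) 0ℓ} (r : RecursiveRel R) where
  allBelow : ℕ → Vec ℕ n → ℕ
  allBelow zero    v = 1
  allBelow (suc k) v = allBelow k v ℕ.* χ r (k ∷ v)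

  allBelowᵣ : Recursive (λ v → allBelow (head v) (tail v))
  allBelowᵣ = primᵣ {g = λ _ → 1} {h = λ { (k ∷ a ∷ v) → a ℕ.* χ r (k ∷ v) }}
    oneᵣ
    (ext (*ᵣ p1 (compᵣ {h = λ { zero → λ w → lookup w 0F ; (suc i) → λ w → lookup w (suc (suc i)) }}
                           (χ-recursive r) (λ { zero → p0 ; (suc i) → projᵣ (suc (suc i)) }) (λ _ → refl)))
         (λ { (k ∷ a ∷ v) → cong (λ w → a ℕ.* χ r (k ∷ w)) (sym (tabulate∘lookup v)) }))
    (λ _ → refl) (λ _ _ → refl)

  allBelow-spec : ∀ k v → ((∀ i → i ℕ.< k → R (i ∷ v)) × allBelow k v ≡ 1)
                        ⊎ ((¬ (∀ i → i ℕ.< k → R (i ∷ v))) × allBelow k v ≡ 0)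
  allBelow-spec zero    v = inj₁ ((λ _ ()) , refl)
  allBelow-spec (suc k) v with allBelow-spec k v | χ-spec r (k ∷ v)
  ... | inj₂ (¬f , e) | _ =
    inj₂ ((λ f → ¬f (λ i i<k → f i (ℕ.m<n⇒m<1+n i<k))) , cong (ℕ._* χ r (k ∷ v)) e)
  ... | inj₁ (_ , _) | inj₂ (¬Rk , e) =
    inj₂ ((λ f → ¬Rk (f k (ℕ.n<1+n k))) , trans (cong (allBelow k v ℕ.*_) e) (ℕ.*-zeroʳ (allBelow k v)))
  ... | inj₁ (f , e) | inj₁ (Rk , e') = inj₁ (f' , cong₂ ℕ._*_ e e')
    where
    f' : ∀ i → i ℕ.< suc k → R (i ∷ v)
    f' i i<1+k with i ℕ.≟ k
    ... | yes refl = Rk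
    ... | no  i≢k  = f i (ℕ.≤∧≢⇒< (ℕ.s≤s⁻¹ i<1+k) i≢k)

  ∀<ᵣ : ∀ {b : Vec ℕ n → ℕ} → Recursive b → RecursiveRel (λ v → ∀ i → i ℕ.< b v → R (i ∷ v))
  ∀<ᵣ {b} rb .χ v = allBelow (b v) v
  ∀<ᵣ {b} rb .χ-recursive =
    compᵣ {h = λ { zero → b ; (suc i) v → lookup v i }} allBelowᵣ
          (λ { zero → rb ; (suc i) → projᵣ i })
          (λ v → cong (allBelow (b v)) (sym (tabulate∘lookup v)))
  ∀<ᵣ {b} rb .χ-spec v = allBelow-spec (b v) v

rootᵣ : ∀ {n} {g : Vec ℕ n → ℕ} → Recursive g → Recursive (λ v → root (g v))
rootᵣ = ap₁ root (primᵣ {g = λ _ → 0} {h = step} zeroᵣ stepᵣ (λ _ → refl) (λ k v → root-suc k))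
  where
  eq? : ℕ → ℕ → ℕ
  eq? m n = 1 ∸ ((m ∸ n) ℕ.+ (n ∸ m))
  step : Vec ℕ 2 → ℕ
  step w = lookup w 1F ℕ.+ eq? (suc (lookup w 0F)) (tri (suc (lookup w 1F)))
  stepᵣ : Recursive step
  stepᵣ = +ᵣ p1 (∸ᵣ oneᵣ (+ᵣ (∸ᵣ (sᵣ p0) (triᵣ (sᵣ p1))) (∸ᵣ (triᵣ (sᵣ p1)) (sᵣ p0))))
  eq?-refl : ∀ m → eq? m m ≡ 1
  eq?-refl m rewrite ℕ.n∸n≡0 m = refl
  eq?-≢ : ∀ m n → m ≢ n → eq? m n ≡ 0
  eq?-≢ zero    zero    m≢n = ⊥-elim (m≢n refl)
  eq?-≢ zero    (suc n) m≢n = ℕ.0∸n≡0 n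
  eq?-≢ (suc m) zero    m≢n = ℕ.0∸n≡0 (m ℕ.+ 0)
  eq?-≢ (suc m) (suc n) m≢n = eq?-≢ m n (m≢n ∘ cong suc)
  root-suc : ∀ k → root (suc k) ≡ root k ℕ.+ eq? (suc k) (tri (suc (root k)))
  root-suc k with suc k ℕ.≟ tri (suc (root k))
  ... | yes e = trans (root-yes k e)
                      (trans (sym (ℕ.+-comm (root k) 1))
                             (cong (root k ℕ.+_) (sym (trans (cong (eq? (suc k)) (sym e)) (eq?-refl (suc k))))))
  ... | no ne = trans (root-no k ne)
                      (trans (sym (ℕ.+-identityʳ (root k)))
                             (cong (root k ℕ.+_) (sym (eq?-≢ (suc k) (tri (suc (root k))) ne))))

module _ {n} {g : Vec ℕ n → ℕ} (rg : Recursive g) where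
  π₂ᵣ : Recursive (λ v → π₂ (g v))
  π₂ᵣ = ∸ᵣ rg (triᵣ (rootᵣ rg))

  π₁ᵣ : Recursive (λ v → π₁ (g v))
  π₁ᵣ = ∸ᵣ (rootᵣ rg) π₂ᵣ

entryᵣ : ∀ {n} {g h : Vec ℕ n → ℕ} → Recursive g → Recursive h →
         Recursive (λ v → entry (g v) (h v))
entryᵣ rg rh =
  π₁ᵣ (ap₂ (λ k s → drop s k)
           (primᵣ {h = λ w → π₂ (lookup w 1F)} p0 (π₂ᵣ p1) (λ _ → refl) (λ _ _ → refl))
           rh rg)

-- Dedekind cuts of ℚ: L is {q | q < x} and U is {q | x < q}.
record ℝ : Set₁ where
  field
    L U         : Pred ℚᵘ 0ℓ
    L-inhabited : ∃ L
    U-inhabited : ∃ U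
    L-down      : ∀ {p q} → p ℚ.< q → L q → L p
    L-open      : ∀ {p} → L p → ∃ λ q → p ℚ.< q × L q
    U-up        : ∀ {p q} → p ℚ.< q → U p → U q
    U-open      : ∀ {q} → U q → ∃ λ p → p ℚ.< q × U p
    disjoint    : ∀ q → ¬ (L q × U q)
    located     : ∀ {p q} → p ℚ.< q → L p ⊎ U q

infix 4 _<ᴿ_ _≤ᴿ_

_<ᴿ_ _≤ᴿ_ : ℝ → ℚᵘ → Set
x <ᴿ q = ℝ.U x q
x ≤ᴿ q = ¬ ℝ.L x q

fromℚ : ℚᵘ → ℝ
fromℚ x = record
  { L           = ℚ._< x
  ; U           = x ℚ.<_
  ; L-inhabited = x ℚ.- 1ℚᵘ , subst (x ℚ.- 1ℚᵘ ℚ.<_) (ℚ.+-identityʳ-≡ x) (ℚ.+-monoʳ-< x (*<* ℤ.-<+))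
  ; U-inhabited = x ℚ.+ 1ℚᵘ , subst (ℚ._< x ℚ.+ 1ℚᵘ) (ℚ.+-identityʳ-≡ x) (ℚ.+-monoʳ-< x (*<* (ℤ.+<+ (s≤s z≤n))))
  ; L-down      = ℚ.<-trans
  ; L-open      = ℚ.<-dense
  ; U-up        = λ p<q x<p → ℚ.<-trans x<p p<q
  ; U-open      = λ x<q → let m , x<m , m<q = ℚ.<-dense x<q in m , m<q , x<m
  ; disjoint    = λ _ (q<x , x<q) → ℚ.<-irrefl ℚ.≃-refl (ℚ.<-trans q<x x<q)
  ; located     = fromℚ-located
  }
  where
  fromℚ-located : ∀ {p q} → p ℚ.< q → p ℚ.< x ⊎ x ℚ.< q
  fromℚ-located {p} {q} p<q with p ℚ.<? x
  ... | yes p<x = inj₁ p<x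
  ... | no  p≮x = inj₂ (ℚ.≤-<-trans (ℚ.≮⇒≥ p≮x) p<q)

_⊔ᴿ_ : ℝ → ℝ → ℝ
x ⊔ᴿ y = record
  { L           = λ q → X.L q ⊎ Y.L q
  ; U           = λ q → X.U q × Y.U q
  ; L-inhabited = let q , l = X.L-inhabited in q , inj₁ l
  ; U-inhabited = U-inh X.U-inhabited Y.U-inhabited
  ; L-down      = λ { p<q (inj₁ l) → inj₁ (X.L-down p<q l)
                    ; p<q (inj₂ l) → inj₂ (Y.L-down p<q l) }
  ; L-open      = λ { (inj₁ l) → let q , p<q , l' = X.L-open l in q , p<q , inj₁ l'
                    ; (inj₂ l) → let q , p<q , l' = Y.L-open l in q , p<q , inj₂ l' }
  ; U-up        = λ p<q (u , u') → X.U-up p<q u , Y.U-up p<q u'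
  ; U-open      = λ (u , u') → U-opn (X.U-open u) (Y.U-open u')
  ; disjoint    = λ { q (inj₁ l , u , _) → X.disjoint q (l , u)
                    ; q (inj₂ l , _ , u) → Y.disjoint q (l , u) }
  ; located     = loc
  }
  where
  module X = ℝ x
  module Y = ℝ y
  ≤-up : ∀ {z p q} → p ℚ.≤ q → ℝ.U z p → ℝ.U z q
  ≤-up {z} p≤q u = let p' , p'<p , u' = ℝ.U-open z u in ℝ.U-up z (ℚ.<-≤-trans p'<p p≤q) u'
  U-inh : ∃ X.U → ∃ Y.U → ∃ λ q → X.U q × Y.U q
  U-inh (q , u) (q' , u') with ℚ.≤-total q q'
  ... | inj₁ q≤q' = q' , ≤-up {x} q≤q' u , u'
  ... | inj₂ q'≤q = q , u , ≤-up {y} q'≤q u'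
  U-opn : ∀ {q} → (∃ λ p → p ℚ.< q × X.U p) → (∃ λ p → p ℚ.< q × Y.U p) →
          ∃ λ p → p ℚ.< q × X.U p × Y.U p
  U-opn (p , p<q , u) (p' , p'<q , u') with ℚ.≤-total p p'
  ... | inj₁ p≤p' = p' , p'<q , ≤-up {x} p≤p' u , u'
  ... | inj₂ p'≤p = p , p<q , u , ≤-up {y} p'≤p u'
  loc : ∀ {p q} → p ℚ.< q → (X.L p ⊎ Y.L p) ⊎ (X.U q × Y.U q)
  loc p<q with X.located p<q | Y.located p<q
  ... | inj₁ l | _       = inj₁ (inj₁ l)
  ... | inj₂ _ | inj₁ l  = inj₁ (inj₂ l)
  ... | inj₂ u | inj₂ u' = inj₂ (u , u')

-- m / (k + 1)
frac : ℕ → ℕ → ℚᵘ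
frac m k = mkℚᵘ (+ m) k

rel₄ : (ℕ → ℕ → ℕ → ℕ → Set) → Pred (Vec ℕ 4) 0ℓ
rel₄ R v = R (lookup v 0F) (lookup v 1F) (lookup v 2F) (lookup v 3F)

-- A Polish space with a complete compatible metric d and a recursive
-- presentation r of it.
record RPPolish : Set₁ where
  field
    points : Setoid 0ℓ 0ℓ
  open Setoid points public using (Carrier; _≈_)
  field
    d        : Carrier → Carrier → ℝ
    d-nonneg : ∀ x y → ¬ (d x y <ᴿ 0ℚᵘ)
    d-zero   : ∀ x y → x ≈ y ⇔ d x y ≤ᴿ 0ℚᵘ
    d-sym    : ∀ x y q → d x y <ᴿ q → d y x <ᴿ q
    -- equivalent to d x z ≤ d x y + d y z
    triangle : ∀ x y z p q → d x y <ᴿ p → d y z <ᴿ q → d x z <ᴿ p ℚ.+ q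

  Cauchy : (ℕ → Carrier) → Set
  Cauchy s = ∀ q → 0ℚᵘ ℚ.< q →
             ∃ λ N → ∀ m n → N ℕ.≤ m → N ℕ.≤ n → d (s m) (s n) <ᴿ q

  _⟶_ : (ℕ → Carrier) → Carrier → Set
  s ⟶ x = ∀ q → 0ℚᵘ ℚ.< q → ∃ λ N → ∀ n → N ℕ.≤ n → d (s n) x <ᴿ q

  field
    complete    : ∀ s → Cauchy s → ∃ λ x → s ⟶ x
    r           : ℕ → Carrier
    dense       : ∀ x q → 0ℚᵘ ℚ.< q → ∃ λ i → d x (r i) <ᴿ q
    <-recursive : RecursiveRel (rel₄ λ i j m k → d (r i) (r j) <ᴿ frac m k)
    ≤-recursive : RecursiveRel (rel₄ λ i j m k → d (r i) (r j) ≤ᴿ frac m k)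

open RPPolish using (Carrier)

-- N(X,s) is the open ball with centre r_{(s)₀} and radius (s)₁ / ((s)₂ + 1);
-- in particular N(X,0) is empty.
N : (X : RPPolish) → ℕ → Pred (Carrier X) 0ℓ
N X s x = RPPolish.d X x (RPPolish.r X (entry s 0)) <ᴿ frac (entry s 1) (entry s 2)

frac-< : ∀ {a k b l} → a ℕ.* suc l ℕ.< b ℕ.* suc k → frac a k ℚ.< frac b l
frac-< {a} {k} {b} {l} lt =
  *<* (subst₂ ℤ._<_ (ℤ.pos-* a (suc l)) (ℤ.pos-* b (suc k)) (ℤ.+<+ lt))

frac-<⁻¹ : ∀ {a k b l} → frac a k ℚ.< frac b l → a ℕ.* suc l ℕ.< b ℕ.* suc k
frac-<⁻¹ {a} {k} {b} {l} (*<* lt) =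
  ℤ.drop‿+<+ (subst₂ ℤ._<_ (sym (ℤ.pos-* a (suc l))) (sym (ℤ.pos-* b (suc k))) lt)

frac-≮0 : ∀ {a k} → ¬ (frac a k ℚ.< 0ℚᵘ)
frac-≮0 {a} {k} lt with frac-<⁻¹ {a} {k} {0} {0} lt
... | ()

<-pos : ∀ {a k} {q} → frac a k ℚ.< q → 0ℚᵘ ℚ.< q
<-pos {a} {k} {q} lt with 0ℚᵘ ℚ.<? q
... | yes 0<q = 0<q
... | no  0≮q = ⊥-elim (frac-≮0 {a} {k} (ℚ.<-≤-trans lt (ℚ.≮⇒≥ 0≮q)))

unit : ℕ → ℚᵘ
unit = frac 1

0<unit : ∀ n → 0ℚᵘ ℚ.< unit n
0<unit n = frac-< {0} {0} {1} {n} (s≤s z≤n)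

unit-anti : ∀ {m n} → m ℕ.≤ n → unit n ℚ.≤ unit m
unit-anti {m} {n} m≤n =
  ℚ.≮⇒≥ (λ lt → ℕ.<-irrefl refl (ℕ.<-≤-trans (frac-<⁻¹ {1} {m} {1} {n} lt) (ℕ.*-monoʳ-≤ 1 (s≤s m≤n))))

archimedean : ∀ q → 0ℚᵘ ℚ.< q → ∃ λ n → unit n ℚ.< q
archimedean (mkℚᵘ (+ zero)     k) (*<* (ℤ.+<+ ()))
archimedean (mkℚᵘ (+ (suc a))  k) _ =
  suc k , frac-< {1} {suc k} {suc a} {k}
    (ℕ.≤-trans (ℕ.≤-reflexive (cong suc (ℕ.*-identityˡ (suc k)))) (ℕ.m≤m+n (suc (suc k)) _))
archimedean (mkℚᵘ -[1+ a ]     k) (*<* ())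

p<p+q : ∀ {p q} → 0ℚᵘ ℚ.< q → p ℚ.< p ℚ.+ q
p<p+q {p} {q} 0<q = subst (ℚ._< p ℚ.+ q) (ℚ.+-identityʳ-≡ p) (ℚ.+-monoʳ-< p 0<q)

q<p+q : ∀ {p q} → 0ℚᵘ ℚ.< p → q ℚ.< p ℚ.+ q
q<p+q {p} {q} 0<p = subst (ℚ._< p ℚ.+ q) (ℚ.+-identityˡ-≡ q) (ℚ.+-monoˡ-< q 0<p)

-- ω with the 0/1 metric and r i = i.
ω : RPPolish
ω = record
  { points      = setoid ℕ
  ; d           = λ i j → fromℚ (δ i j)
  ; d-nonneg    = δ-nonneg
  ; d-zero      = λ i j → mk⇔ (to i j) (from i j)
  ; d-sym       = λ i j q → subst (ℚ._< q) (δ-sym i j)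
  ; triangle    = tri'
  ; complete    = λ s c → let N , h = c 1ℚᵘ (*<* (ℤ.+<+ (s≤s z≤n))) in
      s N , λ q 0<q → N , λ n N≤n →
        subst (ℚ._< q) (sym (δ-≡ (δ<1 {s n} {s N} (h n N N≤n ℕ.≤-refl)))) 0<q
  ; r           = λ i → i
  ; dense       = λ i q 0<q → i , subst (ℚ._< q) (sym (δ-≡ {i} refl)) 0<q
  ; <-recursive = iffᵣ (∧ᵣ (≤ᵣ oneᵣ p2) (→ᵣ (≤ᵣ p2 (sᵣ p3)) (≡ᵣ p0 p1)))
                       (λ v → q-to (lookup v 0F) (lookup v 1F))
                       (λ v → q-from (lookup v 0F) (lookup v 1F))
  ; ≤-recursive = iffᵣ (→ᵣ (≤ᵣ (sᵣ p2) (sᵣ p3)) (≡ᵣ p0 p1))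
                       (λ v → p-to (lookup v 0F) (lookup v 1F))
                       (λ v → p-from (lookup v 0F) (lookup v 1F))
  }
  where
  δ : ℕ → ℕ → ℚᵘ
  δ i j with i ℕ.≟ j
  ... | yes _ = 0ℚᵘ
  ... | no  _ = 1ℚᵘ
  δ-≡ : ∀ {i j} → i ≡ j → δ i j ≡ 0ℚᵘ
  δ-≡ {i} {j} e with i ℕ.≟ j
  ... | yes _ = refl
  ... | no ne = ⊥-elim (ne e)
  δ-≢ : ∀ {i j} → i ≢ j → δ i j ≡ 1ℚᵘ
  δ-≢ {i} {j} ne with i ℕ.≟ j
  ... | yes e = ⊥-elim (ne e)
  ... | no  _ = refl
  δ-sym : ∀ i j → δ i j ≡ δ j i
  δ-sym i j with i ℕ.≟ j
  ... | yes e = sym (δ-≡ (sym e))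
  ... | no ne = sym (δ-≢ (ne ∘ sym))
  δ-nonneg : ∀ i j → ¬ (δ i j ℚ.< 0ℚᵘ)
  δ-nonneg i j lt with i ℕ.≟ j
  ... | yes _ = frac-≮0 {0} {0} lt
  ... | no  _ = frac-≮0 {1} {0} lt
  δ<1 : ∀ {i j} → δ i j ℚ.< 1ℚᵘ → i ≡ j
  δ<1 {i} {j} lt with i ℕ.≟ j
  ... | yes e = e
  ... | no  _ = ⊥-elim (ℚ.<-irrefl ℚ.≃-refl lt)
  δ-pos : ∀ {i j q} → δ i j ℚ.< q → 0ℚᵘ ℚ.< q
  δ-pos {i} {j} lt with i ℕ.≟ j
  ... | yes _ = lt
  ... | no  _ = <-pos {1} {0} lt
  to : ∀ i j → i ≡ j → ¬ (0ℚᵘ ℚ.< δ i j)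
  to i j e lt = ℚ.<-irrefl ℚ.≃-refl (subst (0ℚᵘ ℚ.<_) (δ-≡ e) lt)
  from : ∀ i j → ¬ (0ℚᵘ ℚ.< δ i j) → i ≡ j
  from i j h with i ℕ.≟ j
  ... | yes e = e
  ... | no  _ = ⊥-elim (h (*<* (ℤ.+<+ (s≤s z≤n))))
  tri' : ∀ x y z p q → δ x y ℚ.< p → δ y z ℚ.< q → δ x z ℚ.< p ℚ.+ q
  tri' x y z p q a b = case x ℕ.≟ y of λ
    { (yes refl) → ℚ.<-trans b (q<p+q {p} (δ-pos {x} {y} a))
    ; (no ne) → case y ℕ.≟ z of λ
      { (yes refl) → ℚ.<-trans a (p<p+q {p} (δ-pos {y} {z} b))
      ; (no _) → ℚ.≤-<-trans (δ≤1 x z)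
                   (ℚ.<-trans (subst (ℚ._< p) (δ-≢ ne) a) (p<p+q {p} (δ-pos {y} {z} b))) } }
    where
    δ≤1 : ∀ i j → δ i j ℚ.≤ 1ℚᵘ
    δ≤1 i j with i ℕ.≟ j
    ... | yes _ = *≤* (ℤ.+≤+ z≤n)
    ... | no  _ = ℚ.≤-refl
  q-to : ∀ i j {m k} → δ i j ℚ.< frac m k → (1 ℕ.≤ m) × (m ℕ.≤ suc k → i ≡ j)
  q-to i j {m} {k} lt with i ℕ.≟ j
  ... | yes e = ℕ.≤-trans (frac-<⁻¹ {0} {0} {m} {k} lt) (ℕ.≤-reflexive (ℕ.*-identityʳ m)) , λ _ → e
  ... | no  _ = ℕ.≤-trans (s≤s z≤n) 1+k<m , λ m≤ → ⊥-elim (ℕ.<⇒≱ 1+k<m m≤)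
    where
    1+k<m : suc k ℕ.< m
    1+k<m = subst₂ ℕ._<_ (ℕ.*-identityˡ (suc k)) (ℕ.*-identityʳ m) (frac-<⁻¹ {1} {0} {m} {k} lt)
  q-from : ∀ i j {m k} → (1 ℕ.≤ m) × (m ℕ.≤ suc k → i ≡ j) → δ i j ℚ.< frac m k
  q-from i j {m} {k} (1≤m , f) with i ℕ.≟ j
  ... | yes _ = frac-< {0} {0} {m} {k} (ℕ.≤-trans 1≤m (ℕ.≤-reflexive (sym (ℕ.*-identityʳ m))))
  ... | no ne = frac-< {1} {0} {m} {k}
                  (subst₂ ℕ._<_ (sym (ℕ.*-identityˡ (suc k))) (sym (ℕ.*-identityʳ m)) (ℕ.≰⇒> (ne ∘ f)))
  p-to : ∀ i j {m k} → ¬ (frac m k ℚ.< δ i j) → suc m ℕ.≤ suc k → i ≡ j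
  p-to i j {m} {k} h lt with i ℕ.≟ j
  ... | yes e = e
  ... | no  _ = ⊥-elim (h (frac-< {m} {k} {1} {0}
                  (subst₂ ℕ._<_ (sym (ℕ.*-identityʳ m)) (sym (ℕ.*-identityˡ (suc k))) lt)))
  p-from : ∀ i j {m k} → (suc m ℕ.≤ suc k → i ≡ j) → ¬ (frac m k ℚ.< δ i j)
  p-from i j {m} {k} f lt with i ℕ.≟ j
  ... | yes _ = frac-≮0 {m} {k} lt
  ... | no ne = ne (f (subst₂ ℕ._<_ (ℕ.*-identityʳ m) (ℕ.*-identityˡ (suc k)) (frac-<⁻¹ {m} {k} {1} {0} lt)))

-- The space of sequences in a discrete set A enumerated by c, with
--   d(x,y) = 1/(n+1) for the least n with x n ≠ y n (and 0 if there is none),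
-- and with r i the sequence n ↦ c (i)ₙ, which is eventually c 0.
module Sequences
  {A : Set} (_≟_ : DecidableEquality A) (c : ℕ → A) (c⁻¹ : A → ℕ) (c-c⁻¹ : ∀ a → c (c⁻¹ a) ≡ a)
  (c-≡ᵣ : ∀ {n} {f g : Vec ℕ n → ℕ} → Recursive f → Recursive g →
          RecursiveRel (λ v → c (f v) ≡ c (g v)))
  where

  Agree : (ℕ → A) → (ℕ → A) → ℕ → Set
  Agree x y n = ∀ i → i ℕ.< n → x i ≡ y i

  firstDiff : ∀ x y n → Agree x y n ⊎ ∃ λ k → k ℕ.< n × x k ≢ y k × Agree x y k
  firstDiff x y zero = inj₁ (λ _ ())
  firstDiff x y (suc n) with firstDiff x y n
  ... | inj₂ (k , k<n , rest) = inj₂ (k , ℕ.m<n⇒m<1+n k<n , rest)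
  ... | inj₁ ag with x n ≟ y n
  ...   | no ne = inj₂ (n , ℕ.n<1+n n , ne , ag)
  ...   | yes e = inj₁ λ i i<1+n → case i ℕ.≟ n of λ
    { (yes refl) → e ; (no i≢n) → ag i (ℕ.≤∧≢⇒< (ℕ.s≤s⁻¹ i<1+n) i≢n) }

  dist : (ℕ → A) → (ℕ → A) → ℝ
  dist x y = record
    { L           = λ p → p ℚ.< 0ℚᵘ ⊎ ∃ λ n → p ℚ.< unit n × x n ≢ y n
    ; U           = λ q → ∃ λ n → unit n ℚ.< q × Agree x y n
    ; L-inhabited = ℚ.- 1ℚᵘ , inj₁ (*<* ℤ.-<+)
    ; U-inhabited = frac 2 0 , 0 , frac-< {1} {0} {2} {0} (s≤s (s≤s z≤n)) , λ _ ()
    ; L-down      = λ { p<q (inj₁ l)           → inj₁ (ℚ.<-trans p<q l)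
                      ; p<q (inj₂ (n , l , e)) → inj₂ (n , ℚ.<-trans p<q l , e) }
    ; L-open      = λ { (inj₁ l)           → let m , a , b = ℚ.<-dense l in m , a , inj₁ b
                      ; (inj₂ (n , l , e)) → let m , a , b = ℚ.<-dense l in m , a , inj₂ (n , b , e) }
    ; U-up        = λ p<q (n , l , ag) → n , ℚ.<-trans l p<q , ag
    ; U-open      = λ (n , l , ag) → let m , a , b = ℚ.<-dense l in m , b , n , a , ag
    ; disjoint    = disj
    ; located     = loc
    }
    where
    disj : ∀ q → ¬ ((q ℚ.< 0ℚᵘ ⊎ ∃ λ n → q ℚ.< unit n × x n ≢ y n) ×
                    (∃ λ n → unit n ℚ.< q × Agree x y n))
    disj q (inj₁ q<0 , n , l , _) = frac-≮0 {1} {n} (ℚ.<-trans l q<0)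
    disj q (inj₂ (m , l' , ne) , n , l , ag) with m ℕ.<? n
    ... | yes m<n = ne (ag m m<n)
    ... | no  m≮n = ℚ.<-irrefl ℚ.≃-refl
                      (ℚ.<-trans l' (ℚ.≤-<-trans (unit-anti (ℕ.≮⇒≥ m≮n)) l))
    loc : ∀ {p q} → p ℚ.< q → (p ℚ.< 0ℚᵘ ⊎ ∃ λ n → p ℚ.< unit n × x n ≢ y n) ⊎
                              (∃ λ n → unit n ℚ.< q × Agree x y n)
    loc {p} {q} p<q with 0ℚᵘ ℚ.<? q
    ... | no 0≮q = inj₁ (inj₁ (ℚ.<-≤-trans p<q (ℚ.≮⇒≥ 0≮q)))
    ... | yes 0<q with archimedean q 0<q
    ...   | n , u<q with firstDiff x y n
    ...     | inj₁ ag = inj₂ (n , u<q , ag)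
    ...     | inj₂ (k , _ , ne , ag) with p ℚ.<? unit k
    ...       | yes p<u = inj₁ (inj₂ (k , p<u , ne))
    ...       | no  p≮u = inj₂ (k , ℚ.≤-<-trans (ℚ.≮⇒≥ p≮u) p<q , ag)

  rr : ℕ → ℕ → A
  rr i n = c (entry i n)

  rr-eventually : ∀ i j n → i ℕ.+ j ℕ.≤ n → rr i n ≡ rr j n
  rr-eventually i j n le =
    cong c (trans (entry-≥ i n (ℕ.≤-trans (ℕ.m≤m+n i j) le))
                  (sym (entry-≥ j n (ℕ.≤-trans (ℕ.m≤n+m j i) le))))

  sq-triangle : ∀ x y z p q → dist x y <ᴿ p → dist y z <ᴿ q → dist x z <ᴿ p ℚ.+ q
  sq-triangle x y z p q (m , a , ag) (n , b , ag') with ℕ.≤-total m n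
  ... | inj₁ m≤n = m , ℚ.<-trans a (p<p+q {p} (<-pos {1} {n} b)) ,
                   λ i i<m → trans (ag i i<m) (ag' i (ℕ.<-≤-trans i<m m≤n))
  ... | inj₂ n≤m = n , ℚ.<-trans b (q<p+q {p} (<-pos {1} {m} a)) ,
                   λ i i<n → trans (ag i (ℕ.<-≤-trans i<n n≤m)) (ag' i i<n)

  zero-to : ∀ x y → (∀ n → x n ≡ y n) → dist x y ≤ᴿ 0ℚᵘ
  zero-to x y e (inj₁ l)            = ℚ.<-irrefl ℚ.≃-refl l
  zero-to x y e (inj₂ (n , _ , ne)) = ne (e n)

  zero-from : ∀ x y → dist x y ≤ᴿ 0ℚᵘ → ∀ n → x n ≡ y n
  zero-from x y h n with x n ≟ y n
  ... | yes e = e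
  ... | no ne = ⊥-elim (h (inj₂ (n , 0<unit n , ne)))

  dist<unit : ∀ x y n → dist x y <ᴿ unit n → x n ≡ y n
  dist<unit x y n (m , l , ag) with n ℕ.<? m
  ... | yes n<m = ag n n<m
  ... | no  n≮m = ⊥-elim (ℚ.<-irrefl ℚ.≃-refl (ℚ.<-≤-trans l (unit-anti (ℕ.≮⇒≥ n≮m))))

  module Completeness (s : ℕ → ℕ → A)
    (cau : ∀ q → 0ℚᵘ ℚ.< q → ∃ λ N → ∀ m n → N ℕ.≤ m → N ℕ.≤ n → dist (s m) (s n) <ᴿ q) where
    M : ℕ → ℕ
    M n = proj₁ (cau (unit n) (0<unit n))
    lim : ℕ → A
    lim n = s (M n) n
    S : ℕ → ℕ
    S zero    = 0
    S (suc n) = M n ℕ.⊔ S n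
    M≤S : ∀ n i → i ℕ.< n → M i ℕ.≤ S n
    M≤S (suc n) i i<1+n with i ℕ.≟ n
    ... | yes refl = ℕ.m≤m⊔n (M n) (S n)
    ... | no  i≢n  = ℕ.≤-trans (M≤S n i (ℕ.≤∧≢⇒< (ℕ.s≤s⁻¹ i<1+n) i≢n)) (ℕ.m≤n⊔m (M n) (S n))
    converges : ∀ q → 0ℚᵘ ℚ.< q → ∃ λ N → ∀ n → N ℕ.≤ n → dist (s n) lim <ᴿ q
    converges q 0<q = let k , u<q = archimedean q 0<q in
      S k , λ n S≤n → k , u<q , λ i i<k →
        dist<unit (s n) (s (M i)) i
          (proj₂ (cau (unit i) (0<unit i)) n (M i) (ℕ.≤-trans (M≤S k i i<k) S≤n) ℕ.≤-refl)

  q-to : ∀ i j m k → dist (rr i) (rr j) <ᴿ frac m k →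
         1 ℕ.≤ m × (∀ n → n ℕ.< i ℕ.+ j → m ℕ.* suc n ℕ.≤ suc k → rr i n ≡ rr j n)
  q-to i j m k (n₀ , l , ag) = 1≤m , λ n _ le → ag n (n<n₀ n le)
    where
    lt : suc k ℕ.< m ℕ.* suc n₀
    lt = subst (ℕ._< m ℕ.* suc n₀) (ℕ.*-identityˡ (suc k)) (frac-<⁻¹ {1} {n₀} {m} {k} l)
    1≤m : 1 ℕ.≤ m
    1≤m = ℕ.n≢0⇒n>0 λ { refl → case lt of λ () }
    n<n₀ : ∀ n → m ℕ.* suc n ℕ.≤ suc k → n ℕ.< n₀
    n<n₀ n le = ℕ.s<s⁻¹ (ℕ.*-cancelˡ-< m (suc n) (suc n₀) (ℕ.≤-<-trans le lt))

  q-from : ∀ i j m k →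
           1 ℕ.≤ m × (∀ n → n ℕ.< i ℕ.+ j → m ℕ.* suc n ℕ.≤ suc k → rr i n ≡ rr j n) →
           dist (rr i) (rr j) <ᴿ frac m k
  q-from i j m k (1≤m , f)
    with archimedean (frac m k) (frac-< {0} {0} {m} {k} (ℕ.≤-trans 1≤m (ℕ.≤-reflexive (sym (ℕ.*-identityʳ m)))))
  ... | n , u<q with firstDiff (rr i) (rr j) n
  ...   | inj₁ ag = n , u<q , ag
  ...   | inj₂ (n' , _ , ne , ag) =
    n' , frac-< {1} {n'} {m} {k} (subst (ℕ._< m ℕ.* suc n') (sym (ℕ.*-identityˡ (suc k))) (ℕ.≰⇒> big)) , ag
    where
    big : ¬ (m ℕ.* suc n' ℕ.≤ suc k)
    big le with n' ℕ.<? i ℕ.+ j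
    ... | yes n'< = ne (f n' n'< le)
    ... | no  n'≮ = ne (rr-eventually i j n' (ℕ.≮⇒≥ n'≮))

  p-to : ∀ i j m k → dist (rr i) (rr j) ≤ᴿ frac m k →
         ∀ n → n ℕ.< i ℕ.+ j → suc (m ℕ.* suc n) ℕ.≤ suc k → rr i n ≡ rr j n
  p-to i j m k h n _ lt with rr i n ≟ rr j n
  ... | yes e = e
  ... | no ne = ⊥-elim (h (inj₂ (n , frac-< {m} {k} {1} {n}
                  (subst (m ℕ.* suc n ℕ.<_) (sym (ℕ.*-identityˡ (suc k))) lt) , ne)))

  p-from : ∀ i j m k →
           (∀ n → n ℕ.< i ℕ.+ j → suc (m ℕ.* suc n) ℕ.≤ suc k → rr i n ≡ rr j n) →
           dist (rr i) (rr j) ≤ᴿ frac m k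
  p-from i j m k f (inj₁ l) = frac-≮0 {m} {k} l
  p-from i j m k f (inj₂ (n , l , ne)) with n ℕ.<? i ℕ.+ j
  ... | yes n< = ne (f n n< (subst (m ℕ.* suc n ℕ.<_) (ℕ.*-identityˡ (suc k)) (frac-<⁻¹ {m} {k} {1} {n} l)))
  ... | no  n≮ = ne (rr-eventually i j n (ℕ.≮⇒≥ n≮))

  sequences : RPPolish
  sequences = record
    { points      = ℕ →-setoid A
    ; d           = dist
    ; d-nonneg    = λ x y (n , l , _) → frac-≮0 {1} {n} l
    ; d-zero      = λ x y → mk⇔ (zero-to x y) (zero-from x y)
    ; d-sym       = λ x y q (n , l , ag) → n , l , λ i i<n → sym (ag i i<n)
    ; triangle    = sq-triangle
    ; complete    = λ s c → Completeness.lim s c , Completeness.converges s c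
    ; r           = rr
    ; dense       = λ x q 0<q → let n , u<q = archimedean q 0<q in
        encode (c⁻¹ ∘ x) n , n , u<q , λ i i<n →
          trans (sym (c-c⁻¹ (x i))) (cong c (sym (entry-encode (c⁻¹ ∘ x) n i i<n)))
    ; <-recursive = iffᵣ
        (∧ᵣ (≤ᵣ oneᵣ p2)
            (∀<ᵣ (→ᵣ (≤ᵣ (*ᵣ p3 (sᵣ p0)) (sᵣ (projᵣ 4F))) (c-≡ᵣ (entryᵣ p1 p0) (entryᵣ p2 p0))) (+ᵣ p0 p1)))
        (λ v → q-to (lookup v 0F) (lookup v 1F) (lookup v 2F) (lookup v 3F))
        (λ v → q-from (lookup v 0F) (lookup v 1F) (lookup v 2F) (lookup v 3F))
    ; ≤-recursive = iffᵣ
        (∀<ᵣ (→ᵣ (≤ᵣ (sᵣ (*ᵣ p3 (sᵣ p0))) (sᵣ (projᵣ 4F))) (c-≡ᵣ (entryᵣ p1 p0) (entryᵣ p2 p0))) (+ᵣ p0 p1))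
        (λ v → p-to (lookup v 0F) (lookup v 1F) (lookup v 2F) (lookup v 3F))
        (λ v → p-from (lookup v 0F) (lookup v 1F) (lookup v 2F) (lookup v 3F))
    }

ω^ω : RPPolish
ω^ω = Sequences.sequences ℕ._≟_ (λ n → n) (λ n → n) (λ _ → refl) ≡ᵣ

2^ω : RPPolish
2^ω = Sequences.sequences Bool._≟_ c (λ b → if b then 1 else 0) (λ { false → refl ; true → refl })
        (λ rf rg → iffᵣ (≡ᵣ (∸ᵣ oneᵣ rf) (∸ᵣ oneᵣ rg)) (λ v → to) (λ v → from))
  where
  c : ℕ → Bool
  c zero    = false
  c (suc _) = true
  to : ∀ {m n} → c m ≡ c n → 1 ∸ m ≡ 1 ∸ n
  to {zero}  {zero}  _ = refl
  to {suc m} {suc n} _ = trans (ℕ.0∸n≡0 m) (sym (ℕ.0∸n≡0 n))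
  from : ∀ {m n} → 1 ∸ m ≡ 1 ∸ n → c m ≡ c n
  from {zero}  {zero}  _ = refl
  from {suc m} {suc n} _ = refl
  from {zero}  {suc n} e = contradiction (trans e (ℕ.0∸n≡0 n)) λ ()
  from {suc m} {zero}  e = contradiction (trans (sym e) (ℕ.0∸n≡0 m)) λ ()

infixr 6 _⊗_

-- The product with the maximum metric and r i = (r_{(i)₀}, r_{(i)₁}).
_⊗_ : RPPolish → RPPolish → RPPolish
X ⊗ Y = record
  { points      = ×-setoid X.points Y.points
  ; d           = λ (x , y) (x' , y') → X.d x x' ⊔ᴿ Y.d y y'
  ; d-nonneg    = λ (x , _) (x' , _) (u , _) → X.d-nonneg x x' u
  ; d-zero      = λ (x , y) (x' , y') → mk⇔
      (λ { (e , _) (inj₁ l) → to (X.d-zero x x') e l ; (_ , e) (inj₂ l) → to (Y.d-zero y y') e l })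
      (λ h → from (X.d-zero x x') (h ∘ inj₁) , from (Y.d-zero y y') (h ∘ inj₂))
  ; d-sym       = λ (x , y) (x' , y') q (u , u') → X.d-sym x x' q u , Y.d-sym y y' q u'
  ; triangle    = λ (x , y) (x' , y') (x″ , y″) p q (u , u') (w , w') →
      X.triangle x x' x″ p q u w , Y.triangle y y' y″ p q u' w'
  ; complete    = λ s c →
      let x , s⟶x = X.complete (proj₁ ∘ s) λ q 0<q → let N , h = c q 0<q in
                      N , λ m n a b → proj₁ (h m n a b)
          y , s⟶y = Y.complete (proj₂ ∘ s) λ q 0<q → let N , h = c q 0<q in
                      N , λ m n a b → proj₂ (h m n a b)
      in (x , y) , λ q 0<q →
        let M , f = s⟶x q 0<q
            N , g = s⟶y q 0<q
        in M ℕ.⊔ N , λ n le → f n (ℕ.≤-trans (ℕ.m≤m⊔n M N) le) , g n (ℕ.≤-trans (ℕ.m≤n⊔m M N) le)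
  ; r           = λ i → X.r (entry i 0) , Y.r (entry i 1)
  ; dense       = λ (x , y) q 0<q →
      let i , u = X.dense x q 0<q
          j , w = Y.dense y q 0<q
      in pair i (pair j 0)
       , subst (λ a → X.d x (X.r a) <ᴿ q) (sym (entry-pair-zero i (pair j 0))) u
       , subst (λ a → Y.d y (Y.r a) <ᴿ q)
               (sym (trans (entry-pair-suc i (pair j 0) 0) (entry-pair-zero j 0))) w
  ; <-recursive = ∧ᵣ (substᵣ X.<-recursive (argsᵣ zeroᵣ)) (substᵣ Y.<-recursive (argsᵣ oneᵣ))
  ; ≤-recursive = iffᵣ
      (∧ᵣ (substᵣ X.≤-recursive (argsᵣ zeroᵣ)) (substᵣ Y.≤-recursive (argsᵣ oneᵣ)))
      (λ _ h → h ∘ inj₁ , h ∘ inj₂)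
      (λ { _ (h , _) (inj₁ l) → h l ; _ (_ , h) (inj₂ l) → h l })
  }
  where
  module X = RPPolish X
  module Y = RPPolish Y
  open Equivalence using (to; from)
  args : (Vec ℕ 4 → ℕ) → Fin 4 → Vec ℕ 4 → ℕ
  args e 0F v = entry (lookup v 0F) (e v)
  args e 1F v = entry (lookup v 1F) (e v)
  args e 2F v = lookup v 2F
  args e 3F v = lookup v 3F
  argsᵣ : ∀ {e} → Recursive e → ∀ i → Recursive (args e i)
  argsᵣ re 0F = entryᵣ p0 re
  argsᵣ re 1F = entryᵣ p1 re
  argsᵣ re 2F = p2
  argsᵣ re 3F = p3

N-separates : ∀ X (y y' : Carrier X) → (∀ k → N X k y → N X k y') → RPPolish._≈_ X y y'
N-separates X y y' h = Equivalence.from (d-zero y y') λ l →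
  let q , 0<q , l'    = ℝ.L-open (d y y') l
      m , 0<m , m<q   = ℚ.<-dense 0<q
      a , ua<m        = archimedean m 0<m
      b , ub<q-m      = archimedean (q ℚ.- m) (0<-diff m q m<q)
      n               = a ℕ.⊔ b
      i , yi          = dense y (unit n) (0<unit n)
      y'i             = N-code⁻¹ i n y' (h (code i n) (N-code i n y yi))
      un<m            = ℚ.≤-<-trans (unit-anti (ℕ.m≤m⊔n a b)) ua<m
      un<q-m          = ℚ.≤-<-trans (unit-anti (ℕ.m≤n⊔m a b)) ub<q-m
      2un<q           = ℚ.<-respʳ-≃ (cancel m q) (ℚ.+-mono-< un<m un<q-m)
  in ℝ.disjoint (d y y') q
       (l' , ℝ.U-up (d y y') 2un<q (triangle y (r i) y' _ _ yi (d-sym y' (r i) _ y'i)))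
  where
  open RPPolish X
  triple : ℕ → ℕ → ℕ → ℕ
  triple i n 0 = i
  triple i n 1 = 1
  triple i n _ = n
  code : ℕ → ℕ → ℕ
  code i n = encode (triple i n) 3
  N-code-≡ : ∀ i n z → N X (code i n) z ≡ (d z (r i) <ᴿ unit n)
  N-code-≡ i n z = cong₃ (entry-encode (triple i n) 3 0 (s≤s z≤n)) (entry-encode (triple i n) 3 1 (s≤s (s≤s z≤n)))
                         (entry-encode (triple i n) 3 2 (s≤s (s≤s (s≤s z≤n))))
    where
    cong₃ : ∀ {a a' b b' c c'} → a ≡ a' → b ≡ b' → c ≡ c' →
            (d z (r a) <ᴿ frac b c) ≡ (d z (r a') <ᴿ frac b' c')
    cong₃ refl refl refl = refl
  N-code : ∀ i n z → d z (r i) <ᴿ unit n → N X (code i n) z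
  N-code i n z = subst (λ P → P) (sym (N-code-≡ i n z))
  N-code⁻¹ : ∀ i n z → N X (code i n) z → d z (r i) <ᴿ unit n
  N-code⁻¹ i n z = subst (λ P → P) (N-code-≡ i n z)
  0<-diff : ∀ m q → m ℚ.< q → 0ℚᵘ ℚ.< q ℚ.- m
  0<-diff m q m<q = ℚ.<-respˡ-≃ (ℚ.+-inverseʳ m) (ℚ.+-monoˡ-< (ℚ.- m) m<q)
  cancel : ∀ m q → m ℚ.+ (q ℚ.- m) ℚ.≃ q
  cancel m q = ℚ.≃-trans (ℚ.+-comm m (q ℚ.- m))
    (ℚ.≃-trans (ℚ.+-assoc q (ℚ.- m) m)
      (ℚ.≃-trans (ℚ.+-congʳ q (ℚ.+-inverseˡ m)) (ℚ.+-identityʳ q)))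

data TypeAtMost1 : RPPolish → Set₁ where
  ω-type   : TypeAtMost1 ω
  ω^ω-type : TypeAtMost1 ω^ω
  2^ω-type : TypeAtMost1 2^ω
  ⊗-type   : ∀ {X Y} → TypeAtMost1 X → TypeAtMost1 Y → TypeAtMost1 (X ⊗ Y)

IsOpen : (X : RPPolish) → Pred (Carrier X) 0ℓ → Set
IsOpen X P = ∀ x → P x → ∃ λ q → 0ℚᵘ ℚ.< q × (∀ y → RPPolish.d X x y <ᴿ q → P y)

Σ⁰₁ : (X : RPPolish) → Pred (Carrier X) 0ℓ → Set
Σ⁰₁ X P = ∃ λ ε → RecursiveSeq ε × P ≐ (λ x → ∃ λ i → N X (ε i) x)

RecursiveMap : (X Y : RPPolish) → (Carrier X → Carrier Y) → Set
RecursiveMap X Y f = Σ⁰₁ (X ⊗ ω) (λ (x , k) → N Y k (f x))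

record GoodParametrization : Set₁ where
  field
    G             : (X : RPPolish) → Pred (Carrier (ω^ω ⊗ X)) 0ℓ
    G-Σ           : ∀ X → Σ⁰₁ (ω^ω ⊗ X) (G X)
    open-sections : ∀ X (P : Pred (Carrier X) 0ℓ) →
                    IsOpen X P ⇔ (∃ λ γ → P ≐ (λ x → G X (γ , x)))
    Σ-sections    : ∀ X (P : Pred (Carrier X) 0ℓ) →
                    Σ⁰₁ X P ⇔ (∃ λ γ → RecursiveSeq γ × P ≐ (λ x → G X (γ , x)))
    S-exists      : ∀ X Y → TypeAtMost1 X →
                    ∃ λ (S : Carrier (ω^ω ⊗ X) → Carrier ω^ω) →
                      RecursiveMap (ω^ω ⊗ X) ω^ω S ×
                      (∀ γ x y → G (X ⊗ Y) (γ , x , y) ⇔ G Y (S (γ , x) , y))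

-- Brouwer notations: every countable ordinal is denoted by a term, and
-- ξ ≤ₒ η holds exactly when the ordinal of ξ is at most that of η.  An ordinal
-- has many notations; _≈ₒ_ is equality of the denoted ordinals.
data Ord : Set where
  zero : Ord
  suc  : Ord → Ord
  sup  : (ℕ → Ord) → Ord

infix 4 _≤ₒ_ _<ₒ_ _≈ₒ_

data _≤ₒ_ : Ord → Ord → Set where
  zero≤  : ∀ {η} → zero ≤ₒ η
  suc≤   : ∀ {ξ η} → ξ ≤ₒ η → suc ξ ≤ₒ suc η
  ≤sup   : ∀ {ξ f} n → ξ ≤ₒ f n → ξ ≤ₒ sup f
  sup≤   : ∀ {f η} → (∀ n → f n ≤ₒ η) → sup f ≤ₒ η

_<ₒ_ _≈ₒ_ : Ord → Ord → Set
ξ <ₒ η = suc ξ ≤ₒ η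
ξ ≈ₒ η = ξ ≤ₒ η × η ≤ₒ ξ

1ₒ 2ₒ : Ord
1ₒ = suc zero
2ₒ = suc 1ₒ

_* : (ℕ → ℕ) → ℕ → ℕ
(γ *) i = γ (suc i)

module BorelCodes (𝒢 : GoodParametrization) where
  open GoodParametrization 𝒢

  -- {γ}^{X,Y}(x) is defined and equal to y; by N-separates such a y is unique.
  Value : (X Y : RPPolish) → Carrier ω^ω → Carrier X → Carrier Y → Set
  Value X Y γ x y = ∀ k → N Y k y ⇔ G (X ⊗ ω) (γ , x , k)

  Defined : (X Y : RPPolish) → Carrier ω^ω → Carrier X → Set
  Defined X Y γ x = ∃ (Value X Y γ x)

  -- The transfinite recursion defining BC_ξ is an inductive family: the
  -- premises of step at ξ only mention BC η with η <ₒ ξ.  BC ξ is empty for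
  -- ξ ≈ₒ zero.
  data BC (ξ : Ord) (γ : Carrier ω^ω) : Set where
    base : ξ ≈ₒ 1ₒ → γ 0 ≡ 0 → BC ξ γ
    step : 2ₒ ≤ₒ ξ → γ 0 ≡ 1 →
           (α : ℕ → Carrier ω^ω) → (∀ i → Value ω ω^ω (γ *) i (α i)) →
           (η : ℕ → Ord) → (∀ i → 1ₒ ≤ₒ η i × η i <ₒ ξ) →
           (∀ i → BC (η i) (α i)) →
           BC ξ γ

  BC∪ : Carrier ω^ω → Set
  BC∪ γ = ∃ λ ξ → 1ₒ ≤ₒ ξ × BC ξ γ

  ρξ : (X : RPPolish) → ∀ {ξ γ} → BC ξ γ → Pred (Carrier X) 0ℓ
  ρξ X {γ = γ} (base _ _)           x = ∃ λ i → N X ((γ *) i) x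
  ρξ X         (step _ _ _ _ _ _ b) x = ∃ λ i → ¬ ρξ X (b i) x

  ρ : (X : RPPolish) → ∀ {γ} → BC∪ γ → Pred (Carrier X) 0ℓ
  ρ X (_ , _ , b) = ρξ X b

-- The code u(γ,δ) has the same first entry as γ.  If γ(0) = 0, the preimage
-- {x | ∃ i. (δ, x, γ(i+1)) ∈ G} is Σ⁰₁ uniformly in γ and δ, and its balls are
-- listed after the entry 0; this uses that balls of ω^ω are decidable.  If
-- γ(0) = 1, the tail of u(γ,δ) has to be an index of i ↦ u({γ*}(i), δ).  Let
-- U(e,γ,δ) be u with that index taken to be S(e,(e,γ,δ)).  The relation
-- U(e,{γ*}(i),δ) ∈ N(ω^ω,k) is Σ⁰₁ in (e,γ,δ,i,k), because {γ*}(i) ∈ N(ω^ω,m) is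
-- (γ*,i,m) ∈ G; if ê is a recursive index of it, then u = U(ê,·,·) is as required
-- by the recursion theorem.  Both claims on u follow by induction on γ ∈ BC.

module Submission where

open import Defs
open import Level using (0ℓ)
open import Data.Nat.Base as ℕ using (ℕ; zero; suc; pred; _∸_; z≤n; s≤s)
import Data.Nat.Properties as ℕ
open import Data.Nat.DivMod using (_/_; m/n*n≤m; m≡m%n+[m/n]*n; m%n<n)
open import Data.Integer.Base as ℤ using (+_; -[1+_])
import Data.Integer.Properties as ℤ
open import Data.Rational.Unnormalised.Base as ℚ using (ℚᵘ; mkℚᵘ; 0ℚᵘ)
import Data.Rational.Unnormalised.Properties as ℚ
open import Data.Fin.Base using (Fin; zero; suc; toℕ)
open import Data.Fin.Patterns using (0F; 1F; 2F; 3F; 4F; 5F)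
open import Data.Vec.Base using (Vec; []; _∷_; head; lookup; tabulate)
open import Data.Vec.Properties using (tabulate-cong; lookup∘tabulate)
open import Data.Unit.Base using (⊤; tt)
open import Data.Product.Base using (∃; _×_; _,_; proj₁; proj₂)
open import Data.Sum.Base using (_⊎_; inj₁; inj₂)
open import Data.Empty using (⊥-elim)
open import Function.Base using (_∘_; id)
open import Function.Bundles using (_⇔_; mk⇔; Equivalence)
open import Relation.Nullary using (¬_; yes; no; contradiction)
open import Relation.Unary using (Pred)
open import Relation.Binary.PropositionalEquality
  using (_≡_; refl; sym; trans; cong; cong₂; subst; subst₂)

open RPPolish using (Carrier)
open RecursiveRel using (χ; χ-recursive; χ-spec)
open Equivalence using (to; from)

-- Codes of finite sequences and of balls

-- In an arbitrary recursively presented space the intersection of two balls need not be a ball, and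
-- inclusion between balls need not be decidable, so even the closure of Σ⁰₁ under intersection
-- takes an argument. It rests on a formal notion of inclusion, witnessed by a rational bound on the
-- distance of two centres: the presentation decides it, and around each point of a ball all
-- sufficiently small balls satisfy it. Membership in balls of X and Y is never decided. Codes of
-- balls of X are only copied or replaced by 0, and all tests take place in ω and ω^ω. This keeps u
-- total on all pairs, also where γ is no Borel code or {δ} is nowhere defined.

natᵣ : ∀ {n} k → Recursive {n} (λ _ → k)
natᵣ zero    = zeroᵣ
natᵣ (suc k) = sᵣ (natᵣ k)

module _ {n} {g h : Vec ℕ n → ℕ} (rg : Recursive g) (rh : Recursive h) where
  pairᵣ : Recursive (λ v → pair (g v) (h v))
  pairᵣ = +ᵣ (triᵣ (+ᵣ rg rh)) rh

branch : ℕ → ℕ → ℕ → ℕ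
branch zero    a b = a
branch (suc _) a b = b

branchᵣ : ∀ {n} {f g h : Vec ℕ n → ℕ} → Recursive f → Recursive g → Recursive h →
          Recursive (λ v → branch (f v) (g v) (h v))
branchᵣ {f = f} {g} {h} rf rg rh =
  ext (+ᵣ (*ᵣ (∸ᵣ oneᵣ rf) rg) (*ᵣ (∸ᵣ oneᵣ (∸ᵣ oneᵣ rf)) rh)) (λ v → eq (f v) (g v) (h v))
  where
  eq : ∀ w a b → branch w a b ≡ (1 ∸ w) ℕ.* a ℕ.+ (1 ∸ (1 ∸ w)) ℕ.* b
  eq zero    a b = sym (trans (ℕ.+-identityʳ _) (ℕ.*-identityˡ a))
  eq (suc w) a b rewrite ℕ.0∸n≡0 w = sym (ℕ.*-identityˡ b)

entries : ∀ {n} → ℕ → Vec ℕ n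
entries p = tabulate (entry p ∘ toℕ)

-- Opaque, since unfolding codes and tests during unification is prohibitively slow.
opaque
  encodeVec : ∀ {n} → Vec ℕ n → ℕ
  encodeVec []      = 0
  encodeVec (a ∷ v) = pair a (encodeVec v)

  entries-encodeVec : ∀ {n} (v : Vec ℕ n) → entries (encodeVec v) ≡ v
  entries-encodeVec []      = refl
  entries-encodeVec (a ∷ v) = cong₂ _∷_ (entry-pair-zero a (encodeVec v))
    (trans (tabulate-cong (entry-pair-suc a (encodeVec v) ∘ toℕ)) (entries-encodeVec v))

  encodeVecᵣ : ∀ {m n} {h : Fin m → Vec ℕ n → ℕ} → (∀ i → Recursive (h i)) →
               Recursive (λ v → encodeVec (tabulate λ i → h i v))
  encodeVecᵣ {zero}  rh = zeroᵣ
  encodeVecᵣ {suc m} rh = pairᵣ (rh zero) (encodeVecᵣ (rh ∘ suc))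

-- Codes for spaces: unlike _⊗_, the constructor _⊠_ is injective for unification.
data Space : Set₁ where
  ⌊_⌋ : RPPolish → Space
  _⊠_ : Space → Space → Space

infixr 6 _⊠_

⟦_⟧ : Space → RPPolish
⟦ ⌊ X ⌋ ⟧ = X
⟦ X ⊠ Y ⟧ = ⟦ X ⟧ ⊗ ⟦ Y ⟧

Nat Seq : Space
Nat = ⌊ ω ⌋
Seq = ⌊ ω^ω ⌋

ball : ℕ → ℕ → ℕ → ℕ
ball c m k = encodeVec (c ∷ m ∷ k ∷ [])

ballᵣ : ∀ {n} {f g h : Vec ℕ n → ℕ} → Recursive f → Recursive g → Recursive h →
        Recursive (λ v → ball (f v) (g v) (h v))
ballᵣ {f = f} {g} {h} rf rg rh =
  encodeVecᵣ {h = λ { 0F → f ; 1F → g ; 2F → h }} λ { 0F → rf ; 1F → rg ; 2F → rh }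

-- A record, so that unification does not unfold membership.
record InBall (X : Space) (s : ℕ) (x : Carrier ⟦ X ⟧) : Set where
  constructor inBall
  field
    isInBall : N ⟦ X ⟧ s x

open InBall

module _ {X : Space} {c m k : ℕ} {x : Carrier ⟦ X ⟧} where
  N-ball : N ⟦ X ⟧ (ball c m k) x ≡ (RPPolish.d ⟦ X ⟧ x (RPPolish.r ⟦ X ⟧ c) <ᴿ frac m k)
  N-ball = cong (λ { (c ∷ m ∷ k ∷ []) → RPPolish.d ⟦ X ⟧ x (RPPolish.r ⟦ X ⟧ c) <ᴿ frac m k })
                (entries-encodeVec (c ∷ m ∷ k ∷ []))

  ball⁺ : RPPolish.d ⟦ X ⟧ x (RPPolish.r ⟦ X ⟧ c) <ᴿ frac m k → InBall X (ball c m k) x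
  ball⁺ l = inBall (subst id (sym N-ball) l)

  ball⁻ : InBall X (ball c m k) x → RPPolish.d ⟦ X ⟧ x (RPPolish.r ⟦ X ⟧ c) <ᴿ frac m k
  ball⁻ (inBall l) = subst id N-ball l

empty : ∀ {X x} → ¬ InBall X 0 x
empty {X} (inBall l) = RPPolish.d-nonneg ⟦ X ⟧ _ _ l

opaque
  -- Multiplication by a characteristic value keeps a code or turns it into 0, a code of the empty
  -- ball. A decidable condition can thus be imposed on an enumeration that has to stay total.
  select : ℕ → ℕ → ℕ
  select = ℕ._*_

  selectᵣ : ∀ {n} {f g : Vec ℕ n → ℕ} → Recursive f → Recursive g → Recursive (λ v → select (f v) (g v))
  selectᵣ = *ᵣ

  gate : ∀ {X x s t} {A : Set} → (A × t ≡ 1) ⊎ (¬ A × t ≡ 0) →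
         InBall X (select t s) x ⇔ (A × InBall X s x)
  gate {s = s} (inj₁ (a , refl)) rewrite ℕ.*-identityˡ s = mk⇔ (a ,_) proj₂
  gate         (inj₂ (¬a , refl)) = mk⇔ (λ l → ⊥-elim (empty l)) (λ (a , _) → ⊥-elim (¬a a))

  _when_ : ∀ {n} {R : Pred (Vec ℕ n) 0ℓ} → (Vec ℕ n → ℕ) → RecursiveRel R → Vec ℕ n → ℕ
  (f when r) v = select (χ r v) (f v)

  whenᵣ : ∀ {n} {R : Pred (Vec ℕ n) 0ℓ} {f : Vec ℕ n → ℕ} →
          Recursive f → (r : RecursiveRel R) → Recursive (f when r)
  whenᵣ rf r = selectᵣ (χ-recursive r) rf

  guard : ∀ {X n} {R : Pred (Vec ℕ n) 0ℓ} (f : Vec ℕ n → ℕ) (r : RecursiveRel R) v {x} →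
          InBall X ((f when r) v) x ⇔ (R v × InBall X (f v) x)
  guard f r v = gate (χ-spec r v)

opaque
  -- Under the maximum metric a ball of a product is the product of two balls of the same radius.
  left right : ℕ → ℕ
  left  s = ball (entry (entry s 0) 0) (entry s 1) (entry s 2)
  right s = ball (entry (entry s 0) 1) (entry s 1) (entry s 2)

  leftᵣ : ∀ {n} {f : Vec ℕ n → ℕ} → Recursive f → Recursive (λ v → left (f v))
  leftᵣ rf = ballᵣ (entryᵣ (entryᵣ rf zeroᵣ) zeroᵣ) (entryᵣ rf (natᵣ 1)) (entryᵣ rf (natᵣ 2))

  rightᵣ : ∀ {n} {f : Vec ℕ n → ℕ} → Recursive f → Recursive (λ v → right (f v))
  rightᵣ rf = ballᵣ (entryᵣ (entryᵣ rf zeroᵣ) (natᵣ 1)) (entryᵣ rf (natᵣ 1)) (entryᵣ rf (natᵣ 2))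

  split : ∀ {X Y s x y} → InBall (X ⊠ Y) s (x , y) ⇔ (InBall X (left s) x × InBall Y (right s) y)
  split {X} {Y} {s} {x} {y} = mk⇔
    (λ (inBall (l , l′)) → ball⁺ {X} {entry (entry s 0) 0} {entry s 1} {entry s 2} l ,
                           ball⁺ {Y} {entry (entry s 0) 1} {entry s 1} {entry s 2} l′)
    (λ (l , l′) → inBall (ball⁻ l , ball⁻ l′))

  left-ball : ∀ c m k → left (ball c m k) ≡ ball (entry c 0) m k
  left-ball c m k = cong (λ { (c ∷ m ∷ k ∷ []) → ball (entry c 0) m k }) (entries-encodeVec (c ∷ m ∷ k ∷ []))

  right-ball : ∀ c m k → right (ball c m k) ≡ ball (entry c 1) m k
  right-ball c m k = cong (λ { (c ∷ m ∷ k ∷ []) → ball (entry c 1) m k }) (entries-encodeVec (c ∷ m ∷ k ∷ []))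

-- Every point of ω is a centre, so the presentation itself decides membership.
ω-ballᵣ : ∀ {n} {f g : Vec ℕ n → ℕ} → Recursive f → Recursive g →
          RecursiveRel (λ v → InBall Nat (f v) (g v))
ω-ballᵣ {f = f} {g} rf rg = iffᵣ
  (substᵣ {h = λ { 0F → g ; 1F v → entry (f v) 0 ; 2F v → entry (f v) 1 ; 3F v → entry (f v) 2 }}
    (RPPolish.<-recursive ω)
    (λ { 0F → rg ; 1F → entryᵣ rf zeroᵣ ; 2F → entryᵣ rf (natᵣ 1) ; 3F → entryᵣ rf (natᵣ 2) }))
  (λ _ → isInBall) (λ _ → inBall)

d-ω : ∀ i j q → RPPolish.d ω i j <ᴿ q → q ℚ.≤ unit 0 → i ≡ j
d-ω i j q l q≤1 with i ℕ.≟ j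
... | yes e = e
... | no  _ = ⊥-elim (ℚ.<-irrefl ℚ.≃-refl (ℚ.<-≤-trans l q≤1))

d-ω-refl : ∀ i q → 0ℚᵘ ℚ.< q → RPPolish.d ω i i <ᴿ q
d-ω-refl i q 0<q with i ℕ.≟ i
... | yes _ = 0<q
... | no ne = ⊥-elim (ne refl)

singleton : ∀ {c n k} → InBall Nat (ball c 1 n) k ⇔ (k ≡ c)
singleton {c} {n} {k} = mk⇔
  (λ l → d-ω k c (unit n) (ball⁻ l) (unit-anti {0} {n} z≤n))
  (λ { refl → ball⁺ {Nat} {k} {1} {n} {k} (d-ω-refl k (unit n) (0<unit n)) })

-- Finite intersections of balls

-- A formal inclusion: the ball of radius 1 / (n + 1) about r c lies in the ball
-- coded by s because a / (b + 1) bounds the distance of the centres.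
Inside : ∀ Y (s c n a b : ℕ) → Set
Inside Y s c n a b =
  (RPPolish.d ⟦ Y ⟧ (RPPolish.r ⟦ Y ⟧ c) (RPPolish.r ⟦ Y ⟧ (entry s 0)) <ᴿ frac a b) ×
  frac (a ℕ.* suc n ℕ.+ suc b) (n ℕ.+ b ℕ.* suc n) ℚ.< frac (entry s 1) (entry s 2)

frac-+-unit : ∀ a b n → frac a b ℚ.+ unit n ≡ frac (a ℕ.* suc n ℕ.+ suc b) (n ℕ.+ b ℕ.* suc n)
frac-+-unit a b n = cong (λ i → mkℚᵘ i (n ℕ.+ b ℕ.* suc n))
  (trans (cong (ℤ._+ (ℤ.1ℤ ℤ.* + suc b)) (sym (ℤ.pos-* a (suc n))))
         (cong (ℤ._+_ (+ (a ℕ.* suc n))) (ℤ.*-identityˡ (+ suc b))))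

insideᵣ : ∀ Y {m} {s c n a b : Vec ℕ m → ℕ} →
          Recursive s → Recursive c → Recursive n → Recursive a → Recursive b →
          RecursiveRel (λ v → Inside Y (s v) (c v) (n v) (a v) (b v))
insideᵣ Y {s = s} {c} {n} {a} {b} rs rc rn ra rb = ∧ᵣ
  (substᵣ {h = λ { 0F → c ; 1F v → entry (s v) 0 ; 2F → a ; 3F → b }} (RPPolish.<-recursive ⟦ Y ⟧)
          (λ { 0F → rc ; 1F → entryᵣ rs zeroᵣ ; 2F → ra ; 3F → rb }))
  (iffᵣ (≤ᵣ (sᵣ (*ᵣ (+ᵣ (*ᵣ ra (sᵣ rn)) (sᵣ rb)) (sᵣ (entryᵣ rs (natᵣ 2)))))
            (*ᵣ (entryᵣ rs (natᵣ 1)) (sᵣ (+ᵣ rn (*ᵣ rb (sᵣ rn))))))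
        (λ _ → frac-<⁻¹) (λ _ → frac-<))

module _ (Y : Space) where
  open RPPolish ⟦ Y ⟧

  Inside-sound : ∀ {s c n a b y} → Inside Y s c n a b → d y (r c) <ᴿ unit n → InBall Y s y
  Inside-sound {s} {c} {n} {a} {b} {y} (l , lt) u = inBall (ℝ.U-up (d y _)
    (ℚ.<-respˡ-≃ (ℚ.+-comm (frac a b) (unit n))
      (subst (ℚ._< frac (entry s 1) (entry s 2)) (sym (frac-+-unit a b n)) lt))
    (triangle y (r c) _ (unit n) (frac a b) u l))

  0<upper-bound : ∀ {x y q} → d x y <ᴿ q → 0ℚᵘ ℚ.< q
  0<upper-bound {x} {y} {q} u with 0ℚᵘ ℚ.<? q
  ... | yes 0<q = 0<q
  ... | no  0≮q = let p , p<q , u′ = ℝ.U-open (d x y) u in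
    ⊥-elim (d-nonneg x y (ℝ.U-up (d x y) (ℚ.<-≤-trans p<q (ℚ.≮⇒≥ 0≮q)) u′))

  -- Two rationals p < m fit between the distance of y from the centre and the radius q. The bound a
  -- / (b + 1) is m, and from n₀ on 1 / (n + 1) is smaller than both gaps: m - p absorbs the passage
  -- from y to `r c`, and q - m the radius of the small ball. The quantifier over c comes last, so
  -- that one n can be fixed for finitely many balls before a centre is chosen.
  Inside-complete : ∀ {s y} → InBall Y s y → ∃ λ n₀ → ∃ λ a → ∃ λ b → ∀ n → n₀ ℕ.≤ n → ∀ c →
                    d y (r c) <ᴿ unit n → Inside Y s c n a b
  Inside-complete {s} {y} (inBall l) =
    let p , p<q , dp  = ℝ.U-open (d y (r (entry s 0))) l
        m , p<m , m<q = ℚ.<-dense p<q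
    in go p m p<m m<q dp (ℝ.U-up (d y _) p<m dp)
    where
    q = frac (entry s 1) (entry s 2)
    0<difference : ∀ {p m} → p ℚ.< m → 0ℚᵘ ℚ.< m ℚ.- p
    0<difference {p} p<m = ℚ.<-respˡ-≃ (ℚ.+-inverseʳ p) (ℚ.+-monoˡ-< (ℚ.- p) p<m)
    +-unit-< : ∀ {p m n₁ n} → unit n₁ ℚ.< m ℚ.- p → n₁ ℕ.≤ n → unit n ℚ.+ p ℚ.< m
    +-unit-< {p} {m} u n₁≤n =
      ℚ.<-respʳ-≃ (ℚ.≃-trans (ℚ.+-assoc m (ℚ.- p) p)
                    (ℚ.≃-trans (ℚ.+-congʳ m (ℚ.+-inverseˡ p)) (ℚ.+-identityʳ m)))
        (ℚ.+-monoˡ-< p (ℚ.≤-<-trans (unit-anti n₁≤n) u))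
    go : ∀ p m → p ℚ.< m → m ℚ.< q → d y (r (entry s 0)) <ᴿ p → d y (r (entry s 0)) <ᴿ m →
         ∃ λ n₀ → ∃ λ a → ∃ λ b → ∀ n → n₀ ℕ.≤ n → ∀ c → d y (r c) <ᴿ unit n → Inside Y s c n a b
    -- An upper bound of a distance is positive, so the numerator of m is a natural number.
    go p (mkℚᵘ -[1+ a ] b) _ _ _ dm with 0<upper-bound dm
    ... | ℚ.*<* ()
    go p (mkℚᵘ (+ a) b) p<m m<q dp _ =
      let n₁ , u₁ = archimedean _ (0<difference p<m)
          n₂ , u₂ = archimedean _ (0<difference m<q)
      in n₁ ℕ.⊔ n₂ , a , b , λ n le c u →
           ℝ.U-up (d (r c) _) (+-unit-< {p} {frac a b} u₁ (ℕ.≤-trans (ℕ.m≤m⊔n n₁ n₂) le))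
                  (triangle (r c) y _ (unit n) p (d-sym y (r c) _ u) dp)
         , subst (ℚ._< q) (frac-+-unit a b n)
             (ℚ.<-respˡ-≃ (ℚ.+-comm (unit n) (frac a b))
               (+-unit-< {frac a b} {q} u₂ (ℕ.≤-trans (ℕ.m≤n⊔m n₁ n₂) le)))

maximum : (ℕ → ℕ) → ℕ → ℕ
maximum f zero    = 0
maximum f (suc b) = f b ℕ.⊔ maximum f b

≤-maximum : ∀ f b {j} → j ℕ.< b → f j ℕ.≤ maximum f b
≤-maximum f (suc b) {j} j<1+b with j ℕ.≟ b
... | yes refl = ℕ.m≤m⊔n (f b) (maximum f b)
... | no  j≢b  = ℕ.≤-trans (≤-maximum f b (ℕ.≤∧≢⇒< (ℕ.s≤s⁻¹ j<1+b) j≢b)) (ℕ.m≤n⊔m (f b) (maximum f b))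

bounded-choice : ∀ {P : ℕ → ℕ → Set} b → (∀ j → j ℕ.< b → ∃ (P j)) →
                 ∃ λ f → ∀ j → j ℕ.< b → P j (f j)
bounded-choice {P} b h = (λ j → proj₁ (total j)) , λ j → proj₂ (total j)
  where
  total : ∀ j → ∃ λ a → j ℕ.< b → P j a
  total j with j ℕ.<? b
  ... | yes j<b = proj₁ (h j j<b) , λ _ → proj₂ (h j j<b)
  ... | no  j≮b = 0 , λ j<b → ⊥-elim (j≮b j<b)

coded-choice : ∀ {P : ℕ → ℕ → Set} b → (∀ j → j ℕ.< b → ∃ (P j)) →
               ∃ λ w → ∀ j → j ℕ.< b → P j (entry w j)
coded-choice {P} b h = let f , Pf = bounded-choice b h in
  encode f b , λ j j<b → subst (P j) (sym (entry-encode f b j j<b)) (Pf j j<b)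

-- Radii at most 1 isolate the points of ω.
section : ℕ → ℕ → ℕ → ℕ
section c k n = ball (encodeVec (c ∷ k ∷ [])) 1 n

sectionᵣ : ∀ {n} {f g h : Vec ℕ n → ℕ} → Recursive f → Recursive g → Recursive h →
           Recursive (λ v → section (f v) (g v) (h v))
sectionᵣ {f = f} {g} rf rg rh =
  ballᵣ (encodeVecᵣ {h = λ { 0F → f ; 1F → g }} λ { 0F → rf ; 1F → rg }) oneᵣ rh

in-section : ∀ {Z c k n z j} → InBall (Z ⊠ Nat) (section c k n) (z , j) ⇔
             (RPPolish.d ⟦ Z ⟧ z (RPPolish.r ⟦ Z ⟧ c) <ᴿ unit n × j ≡ k)
in-section {Z} {c} {k} {n} {z} {j} = mk⇔
  (λ l → let l₁ , l₂ = to split l in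
     ball⁻ (subst (λ s → InBall Z s z) left≡ l₁) ,
     to (singleton {n = n}) (subst (λ s → InBall Nat s j) right≡ l₂))
  (λ (l₁ , l₂) → from split
     (subst (λ s → InBall Z s z) (sym left≡) (ball⁺ l₁) ,
      subst (λ s → InBall Nat s j) (sym right≡) (from singleton l₂)))
  where
  C = encodeVec (c ∷ k ∷ [])
  left≡ : left (section c k n) ≡ ball c 1 n
  left≡ = trans (left-ball C 1 n) (cong (λ a → ball (head a) 1 n) (entries-encodeVec (c ∷ k ∷ [])))
  right≡ : right (section c k n) ≡ ball k 1 n
  right≡ = trans (right-ball C 1 n) (cong (λ a → ball (lookup a 1F) 1 n) (entries-encodeVec (c ∷ k ∷ [])))

-- Σ⁰₁ and RecursiveMap as records, which makes their arguments inferable.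
record Enumerable (Z : Space) (P : Pred (Carrier ⟦ Z ⟧) 0ℓ) : Set where
  field
    code           : ℕ → ℕ
    code-recursive : RecursiveSeq code
    enumerates     : ∀ z → P z ⇔ ∃ λ i → InBall Z (code i) z

record Computable (Z Y : Space) (f : Carrier ⟦ Z ⟧ → Carrier ⟦ Y ⟧) : Set where
  constructor computable
  field
    preimages : Enumerable (Z ⊠ Nat) (λ (z , k) → InBall Y k (f z))

open Enumerable
open Computable

Enumerable⇔Σ⁰₁ : ∀ {Z P} → Enumerable Z P ⇔ Σ⁰₁ ⟦ Z ⟧ P
Enumerable⇔Σ⁰₁ = mk⇔
  (λ E → code E , code-recursive E ,
     (λ {z} Pz → let i , l = to (enumerates E z) Pz in i , isInBall l) ,
     λ {z} (i , l) → from (enumerates E z) (i , inBall l))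
  (λ (ε , rε , f , g) → record
     { code           = ε
     ; code-recursive = rε
     ; enumerates     = λ z → mk⇔ (λ Pz → let i , l = f Pz in i , inBall l) (λ (i , inBall l) → g (i , l)) })

headᵣ : Recursive {1} head
headᵣ = ext p0 (λ { (_ ∷ _) → refl })

enumerate : ∀ {Z P n} {h : Vec ℕ n → ℕ} → Recursive h →
            (∀ z → P z ⇔ ∃ λ v → InBall Z (h v) z) → Enumerable Z P
enumerate {Z} {h = h} rh P⇔ = record
  { code           = h ∘ entries
  ; code-recursive = compᵣ {h = λ i v → entry (head v) (toℕ i)} rh
                           (λ i → entryᵣ headᵣ (natᵣ (toℕ i))) (λ _ → refl)
  ; enumerates     = λ z → mk⇔
      (λ Pz → let v , l = to (P⇔ z) Pz in
         encodeVec v , subst (λ v → InBall Z (h v) z) (sym (entries-encodeVec v)) l)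
      (λ (p , l) → from (P⇔ z) (entries p , l))
  }

Enumerable-resp : ∀ {Z P Q} → Enumerable Z P → (∀ z → P z ⇔ Q z) → Enumerable Z Q
Enumerable-resp E P⇔Q = record
  { code           = code E
  ; code-recursive = code-recursive E
  ; enumerates     = λ z → mk⇔ (to (enumerates E z) ∘ from (P⇔Q z)) (to (P⇔Q z) ∘ from (enumerates E z))
  }

-- In the applications f is the identity or a projection, and g is its action on indices of centres.
-- The identity yields intersections and bounded quantifiers, the projections yield their own
-- recursiveness.
module _ {Z Y : Space} (f : Carrier ⟦ Z ⟧ → Carrier ⟦ Y ⟧) {g : ℕ → ℕ} (rg : RecursiveSeq g)
  (nonexpansive : ∀ z c q → RPPolish.d ⟦ Z ⟧ z (RPPolish.r ⟦ Z ⟧ c) <ᴿ q →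
                  RPPolish.d ⟦ Y ⟧ (f z) (RPPolish.r ⟦ Y ⟧ (g c)) <ᴿ q)
  {b : Vec ℕ 2 → ℕ} (rb : Recursive b) {e : Vec ℕ 3 → ℕ} (re : Recursive e) where

  -- The intersection is the union of the small balls formally included in every
  -- e (j ∷ i ∷ k ∷ []); the witnesses of the inclusions are coded by one number.
  finite-intersections : Enumerable (Z ⊠ Nat) λ (z , k) →
    ∃ λ i → ∀ j → j ℕ.< b (i ∷ k ∷ []) → InBall Y (e (j ∷ i ∷ k ∷ [])) (f z)
  finite-intersections = enumerate {h = target when cᵣ}
    (whenᵣ (sectionᵣ p2 p1 p3) cᵣ)
    (λ zk → mk⇔ (complete zk) (λ (v , l) → sound zk v l))
    where
    module Y = RPPolish ⟦ Y ⟧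
    module Z = RPPolish ⟦ Z ⟧
    Condition : Pred (Vec ℕ 5) 0ℓ
    Condition v = ∀ j → j ℕ.< b (lookup v 0F ∷ lookup v 1F ∷ []) →
      Inside Y (e (j ∷ lookup v 0F ∷ lookup v 1F ∷ [])) (g (lookup v 2F)) (lookup v 3F)
             (entry (entry (lookup v 4F) j) 0) (entry (entry (lookup v 4F) j) 1)
    target : Vec ℕ 5 → ℕ
    target v = section (lookup v 2F) (lookup v 1F) (lookup v 3F)
    cᵣ : RecursiveRel Condition
    cᵣ = ∀<ᵣ
      {R = λ w → Inside Y (e (lookup w 0F ∷ lookup w 1F ∷ lookup w 2F ∷ [])) (g (lookup w 3F)) (lookup w 4F)
                   (entry (entry (lookup w 5F) (lookup w 0F)) 0)
                   (entry (entry (lookup w 5F) (lookup w 0F)) 1)}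
      (insideᵣ Y (compᵣ {h = λ { 0F w → lookup w 0F ; 1F w → lookup w 1F ; 2F w → lookup w 2F }} re
                        (λ { 0F → p0 ; 1F → p1 ; 2F → p2 }) (λ _ → refl))
                 (ap₁ g rg p3) (projᵣ 4F)
                 (entryᵣ (entryᵣ (projᵣ 5F) p0) zeroᵣ) (entryᵣ (entryᵣ (projᵣ 5F) p0) oneᵣ))
      (compᵣ {h = λ { 0F v → lookup v 0F ; 1F v → lookup v 1F }} rb (λ { 0F → p0 ; 1F → p1 }) (λ _ → refl))
    complete : ∀ zk → (∃ λ i → ∀ j → j ℕ.< b (i ∷ proj₂ zk ∷ []) → InBall Y (e (j ∷ i ∷ proj₂ zk ∷ [])) (f (proj₁ zk))) →
               ∃ λ v → InBall (Z ⊠ Nat) ((target when cᵣ) v) zk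
    complete (z , k) (i , l) =
      let n₀ , h = bounded-choice B (λ j j<B → Inside-complete Y (l j j<B))
          -- One radius serves all j below B, since `Inside-complete` holds for every n from `n₀ j`
          -- on.
          n = maximum n₀ B
          c , u = Z.dense z (unit n) (0<unit n)
          w , inside = coded-choice {λ j t → Inside Y (e (j ∷ i ∷ k ∷ [])) (g c) n (entry t 0) (entry t 1)} B λ j j<B →
            let a , a′ , h′ = h j j<B in
            encodeVec (a ∷ a′ ∷ []) ,
            subst (λ { (a ∷ a′ ∷ []) → Inside Y (e (j ∷ i ∷ k ∷ [])) (g c) n a a′ })
                  (sym (entries-encodeVec (a ∷ a′ ∷ [])))
                  (h′ n (≤-maximum n₀ B j<B) (g c) (nonexpansive z c (unit n) u))
          v = i ∷ k ∷ c ∷ n ∷ w ∷ []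
      in v , from (guard target cᵣ v) (inside , from in-section (u , refl))
      where
      B = b (i ∷ k ∷ [])
    sound : ∀ zk v → InBall (Z ⊠ Nat) ((target when cᵣ) v) zk →
            ∃ λ i → ∀ j → j ℕ.< b (i ∷ proj₂ zk ∷ []) → InBall Y (e (j ∷ i ∷ proj₂ zk ∷ [])) (f (proj₁ zk))
    sound (z , k) v@(i ∷ k′ ∷ c ∷ n ∷ w ∷ []) l =
      let inside , l′ = to (guard target cᵣ v) l
          u , k≡k′    = to (in-section {Z} {c} {k′} {n}) l′
      in subst (λ k → ∃ λ i → ∀ j → j ℕ.< b (i ∷ k ∷ []) → InBall Y (e (j ∷ i ∷ k ∷ [])) (f z)) (sym k≡k′)
           (i , λ j j<B → Inside-sound Y (inside j j<B) (nonexpansive z c (unit n) u))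

-- The coordinate k may be used as a number, both in a decidable condition and in computing the
-- ball. This is an intersection of a single ball, whose code is the empty one where `R` fails.
family : ∀ {Z n} {s : Vec ℕ (suc n) → ℕ} → Recursive s →
         {R : Pred (Vec ℕ (suc n)) 0ℓ} → RecursiveRel R →
         Enumerable (Z ⊠ Nat) (λ (z , k) → ∃ λ v → R (k ∷ v) × InBall Z (s (k ∷ v)) z)
family {Z} {n} {s} rs {R} r = Enumerable-resp
  (finite-intersections id headᵣ (λ _ _ _ l → l) oneᵣ
    {e = λ w → (s when r) (lookup w 2F ∷ entries (lookup w 1F))}
    (compᵣ {h = λ { zero w → lookup w 2F ; (suc i) w → entry (lookup w 1F) (toℕ i) }} (whenᵣ rs r)
           (λ { zero → p2 ; (suc i) → entryᵣ p1 (natᵣ (toℕ i)) })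
           (λ _ → refl)))
  (λ (z , k) → mk⇔
    (λ (i , l) → entries i , to (guard s r (k ∷ entries i)) (l 0 (s≤s z≤n)))
    (λ (v , l) → encodeVec v , λ _ _ →
       from (guard s r _) (subst (λ v → R (k ∷ v) × InBall Z (s (k ∷ v)) z) (sym (entries-encodeVec v)) l)))

-- Closure properties of Σ⁰₁ sets and recursive maps

codeᵣ : ∀ {Z P n} (E : Enumerable Z P) {f : Vec ℕ n → ℕ} → Recursive f → Recursive (λ v → code E (f v))
codeᵣ E = ap₁ (code E) (code-recursive E)

code-⊗ω : ∀ {Z P} (E : Enumerable (Z ⊠ Nat) P) → ∀ {z k} →
          P (z , k) ⇔ ∃ λ i → InBall Nat (right (code E i)) k × InBall Z (left (code E i)) z
code-⊗ω E {z} {k} = mk⇔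
  (λ p → let i , l = to (enumerates E (z , k)) p ; l₁ , l₂ = to split l in i , l₂ , l₁)
  (λ (i , l₂ , l₁) → from (enumerates E (z , k)) (i , from split (l₁ , l₂)))

-- This covers projection along ω, with h the identity, and preimages under a recursive map, with h
-- the enumeration of the target set.
∃-imageᵉ : ∀ {Z P h} → Enumerable (Z ⊠ Nat) P → RecursiveSeq h → Enumerable Z (λ z → ∃ λ n → P (z , h n))
∃-imageᵉ {Z} {P} {h} E rh = enumerate {h = s when r} (whenᵣ (leftᵣ (codeᵣ E p1)) r)
  (λ z → mk⇔
    (λ (n , p) → let i , l = to (code-⊗ω E) p in n ∷ i ∷ [] , from (guard s r _) l)
    (λ { (n ∷ i ∷ [] , l) → n , from (code-⊗ω E) (i , to (guard s r _) l) }))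
  where
  s : Vec ℕ 2 → ℕ
  s v = left (code E (lookup v 1F))
  r : RecursiveRel (λ v → InBall Nat (right (code E (lookup v 1F))) (h (lookup v 0F)))
  r = ω-ballᵣ (rightᵣ (codeᵣ E p1)) (ap₁ h rh p0)

∃ᵉ : ∀ {Z P} → Enumerable (Z ⊠ Nat) P → Enumerable Z (λ z → ∃ λ n → P (z , n))
∃ᵉ E = ∃-imageᵉ E headᵣ

_∘ᵉ_ : ∀ {Z Y P f} → Enumerable Y P → Computable Z Y f → Enumerable Z (P ∘ f)
_∘ᵉ_ {f = f} E F = Enumerable-resp (∃-imageᵉ (preimages F) (code-recursive E))
                                   (λ z → mk⇔ (from (enumerates E (f z))) (to (enumerates E (f z))))

_∩ᵉ_ : ∀ {Z P Q} → Enumerable Z P → Enumerable Z Q → Enumerable Z (λ z → P z × Q z)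
_∩ᵉ_ {Z} {P} {Q} E E′ = Enumerable-resp
  (∃ᵉ (finite-intersections id headᵣ (λ _ _ _ l → l) (natᵣ 2)
        {e = λ w → branch (lookup w 0F) (code E (entry (lookup w 1F) 0)) (code E′ (entry (lookup w 1F) 1))}
        (branchᵣ p0 (codeᵣ E (entryᵣ p1 (natᵣ 0))) (codeᵣ E′ (entryᵣ p1 (natᵣ 1))))))
  (λ z → mk⇔
    (λ (_ , i , l) → from (enumerates E z) (entry i 0 , l 0 (s≤s z≤n)) ,
                     from (enumerates E′ z) (entry i 1 , l 1 (s≤s (s≤s z≤n))))
    (λ (p , q) →
      let i , l  = to (enumerates E z) p
          j , l′ = to (enumerates E′ z) q
      in 0 , encodeVec (i ∷ j ∷ []) , λ
        { 0             _ → subst (λ v → InBall Z (code E (lookup v 0F)) z) (sym (entries-encodeVec (i ∷ j ∷ []))) l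
        ; 1             _ → subst (λ v → InBall Z (code E′ (lookup v 1F)) z) (sym (entries-encodeVec (i ∷ j ∷ []))) l′
        ; (suc (suc _)) (s≤s (s≤s ())) }))

-- A witness w codes, for each j below b, the index of one ball of the enumeration of P; the finite
-- intersection of these balls is what remains.
∀<ᵉ : ∀ {Z P} → Enumerable (Z ⊠ Nat) P → Enumerable (Z ⊠ Nat) (λ (z , b) → ∀ j → j ℕ.< b → P (z , j))
∀<ᵉ {Z} {P} E = Enumerable-resp
  (finite-intersections id headᵣ (λ _ _ _ l → l) p1 (whenᵣ (leftᵣ (codeᵣ E (entryᵣ p1 p0))) r))
  (λ (z , b) → mk⇔
    (λ (w , l) j j<b → from (code-⊗ω E) (entry w j , to (guard s r _) (l j j<b)))
    (λ p → let w , l = coded-choice b (λ j j<b → to (code-⊗ω E) (p j j<b)) in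
       w , λ j j<b → from (guard s r (j ∷ w ∷ b ∷ [])) (l j j<b)))
  where
  s : Vec ℕ 3 → ℕ
  s v = left (code E (entry (lookup v 1F) (lookup v 0F)))
  r : RecursiveRel (λ v → InBall Nat (right (code E (entry (lookup v 1F) (lookup v 0F)))) (lookup v 0F))
  r = ω-ballᵣ (rightᵣ (codeᵣ E (entryᵣ p1 p0))) p0

reindexᵉ : ∀ {Z P h} → Enumerable (Z ⊠ Nat) P → RecursiveSeq h → Enumerable (Z ⊠ Nat) (λ (z , k) → P (z , h k))
reindexᵉ {h = h} E rh = Enumerable-resp
  (family (leftᵣ (codeᵣ E p1)) (ω-ballᵣ (rightᵣ (codeᵣ E p1)) (ap₁ h rh p0)))
  (λ (z , k) → mk⇔ (λ { (i ∷ [] , l) → from (code-⊗ω E) (i , l) })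
                   (λ p → let i , l = to (code-⊗ω E) p in i ∷ [] , l))

nonexpansiveᶜ : ∀ {Z Y} (f : Carrier ⟦ Z ⟧ → Carrier ⟦ Y ⟧) {g} → RecursiveSeq g →
             (∀ z c q → RPPolish.d ⟦ Z ⟧ z (RPPolish.r ⟦ Z ⟧ c) <ᴿ q →
                        RPPolish.d ⟦ Y ⟧ (f z) (RPPolish.r ⟦ Y ⟧ (g c)) <ᴿ q) →
             Computable Z Y f
nonexpansiveᶜ f rg nonexpansive = computable (Enumerable-resp
  (finite-intersections f rg nonexpansive oneᵣ p2)
  (λ _ → mk⇔ (λ (_ , l) → l 0 (s≤s z≤n)) (λ l → 0 , λ _ _ → l)))

infixr 9 _∘ᶜ_
infixr 4 _,ᶜ_

_∘ᶜ_ : ∀ {Z Y W f g} → Computable Y W g → Computable Z Y f → Computable Z W (g ∘ f)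
_∘ᶜ_ {f = f} G F = computable (Enumerable-resp
  (family (leftᵣ (codeᵣ (preimages F) p2))
    (∧ᵣ (ω-ballᵣ (rightᵣ (codeᵣ (preimages G) p1)) p0)
        (ω-ballᵣ (rightᵣ (codeᵣ (preimages F) p2)) (leftᵣ (codeᵣ (preimages G) p1)))))
  (λ (z , k) → mk⇔
    (λ { (i ∷ j ∷ [] , (l₁ , l₂) , l) →
         from (code-⊗ω (preimages G)) (i , l₁ , from (code-⊗ω (preimages F)) (j , l₂ , l)) })
    (λ p → let i , l₁ , l′ = to (code-⊗ω (preimages G)) p
               j , l₂ , l  = to (code-⊗ω (preimages F)) l′
           in i ∷ j ∷ [] , (l₁ , l₂) , l)))

_,ᶜ_ : ∀ {Z X Y f g} → Computable Z X f → Computable Z Y g → Computable Z (X ⊠ Y) (λ z → f z , g z)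
F ,ᶜ G = computable (Enumerable-resp (reindexᵉ (preimages F) (leftᵣ headᵣ) ∩ᵉ reindexᵉ (preimages G) (rightᵣ headᵣ))
  (λ _ → mk⇔ (from split) (to split)))

idᶜ : ∀ {Z} → Computable Z Z (λ z → z)
idᶜ = nonexpansiveᶜ id headᵣ (λ _ _ _ l → l)

fstᶜ : ∀ {Z X Y f} → Computable Z (X ⊠ Y) f → Computable Z X (λ z → proj₁ (f z))
fstᶜ {X = X} {Y} F =
  nonexpansiveᶜ {X ⊠ Y} {X} proj₁ (entryᵣ headᵣ (natᵣ 0)) (λ _ _ _ → proj₁) ∘ᶜ F

sndᶜ : ∀ {Z X Y f} → Computable Z (X ⊠ Y) f → Computable Z Y (λ z → proj₂ (f z))
sndᶜ {X = X} {Y} F =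
  nonexpansiveᶜ {X ⊠ Y} {Y} proj₂ (entryᵣ headᵣ (natᵣ 1)) (λ _ _ _ → proj₂) ∘ᶜ F

sequenceᶜ : ∀ {Z h f} → RecursiveSeq h → Computable Z Nat f → Computable Z Nat (h ∘ f)
sequenceᶜ {h = h} rh F = computable (Enumerable-resp
  (family (ballᵣ p1 oneᵣ zeroᵣ) (ω-ballᵣ p0 (ap₁ h rh p1)))
  (λ (n , k) → mk⇔
    (λ { (m ∷ [] , l , l′) → subst (λ n → InBall Nat k (h n)) (sym (to (singleton {n = 0}) l′)) l })
    (λ l → n ∷ [] , l , from singleton refl))) ∘ᶜ F

graphᵉ : ∀ {Z f g} → Computable Z Nat f → Computable Z Nat g → Enumerable Z (λ z → f z ≡ g z)
graphᵉ F G = Enumerable-resp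
  (reindexᵉ {h = λ c → ball c 1 0} (preimages F) (ballᵣ headᵣ oneᵣ zeroᵣ) ∘ᵉ (idᶜ ,ᶜ G))
  (λ _ → mk⇔ (to singleton) (from singleton))

-- With this, a number-valued function may be specified by an existential search for its value
-- together with auxiliary witnesses, such as finite approximations of sequences.
fromGraph : ∀ {Z f} → Enumerable (Z ⊠ Nat) (λ (z , n) → f z ≡ n) → Computable Z Nat f
fromGraph {Z} {f} E = computable (Enumerable-resp
  (family (leftᵣ (codeᵣ E p1)) (∧ᵣ (ω-ballᵣ (rightᵣ (codeᵣ E p1)) p2) (ω-ballᵣ p0 p2)))
  (λ (z , k) → mk⇔
    (λ { (i ∷ n ∷ [] , (l₁ , l) , l₂) → subst (InBall Nat k) (sym (from (code-⊗ω E) (i , l₁ , l₂))) l })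
    (λ l → let i , l₁ , l₂ = to (code-⊗ω E {z} {f z}) refl in i ∷ f z ∷ [] , (l₁ , l) , l₂)))

∀ᵉ : ∀ {Z n} {P : Fin n → Pred (Carrier ⟦ Z ⟧) 0ℓ} → (∀ i → Enumerable Z (P i)) →
     Enumerable Z (λ z → ∀ i → P i z)
-- The empty conjunction is the whole space, which the balls of radius 1 about the dense sequence
-- cover.
∀ᵉ {Z} {zero} E = Enumerable-resp
  (enumerate {h = λ v → ball (lookup v 0F) 1 0} (ballᵣ p0 oneᵣ zeroᵣ)
    (λ z → mk⇔ {A = ⊤} (λ _ → let c , l = RPPolish.dense ⟦ Z ⟧ z (unit 0) (0<unit 0) in c ∷ [] , ball⁺ l) (λ _ → tt)))
  (λ z → mk⇔ (λ _ ()) (λ _ → tt))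
∀ᵉ {Z} {suc n} E = Enumerable-resp (E zero ∩ᵉ ∀ᵉ (E ∘ suc))
  (λ z → mk⇔ (λ { (p , q) zero → p ; (p , q) (suc i) → q i }) (λ p → p zero , p ∘ suc))

liftᶜ : ∀ {Z n} {h : Vec ℕ n → ℕ} {f : Fin n → Carrier ⟦ Z ⟧ → ℕ} → Recursive h →
        (∀ i → Computable Z Nat (f i)) → Computable Z Nat (λ z → h (tabulate λ i → f i z))
liftᶜ {Z} {h = h} {f} rh F = fromGraph (Enumerable-resp
  (∃ᵉ (∀ᵉ (λ i → graphᵉ (F i ∘ᶜ fstᶜ (fstᶜ idᶜ))
                        (sequenceᶜ {h = λ w → entry w (toℕ i)} (entryᵣ headᵣ (natᵣ (toℕ i))) (sndᶜ idᶜ)))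
       ∩ᵉ graphᵉ (sequenceᶜ {h = h ∘ entries} (compᵣ {h = λ i w → entry (head w) (toℕ i)} rh
                              (λ i → entryᵣ headᵣ (natᵣ (toℕ i))) (λ _ → refl)) (sndᶜ idᶜ))
                 (sndᶜ (fstᶜ idᶜ))))
  (λ (z , n) → mk⇔
    (λ (w , e , e′) → trans (cong h (tabulate-cong e)) e′)
    (λ { refl →
      let v  = tabulate (λ i → f i z)
          e  = entries-encodeVec v
      in encodeVec v
       , (λ i → trans (sym (lookup∘tabulate (λ i → f i z) i))
                  (trans (cong (λ v → lookup v i) (sym e)) (lookup∘tabulate (entry (encodeVec v) ∘ toℕ) i)))
       , cong h e })))

lift₂ᶜ : ∀ {Z f g} (h : ℕ → ℕ → ℕ) → Recursive {2} (λ v → h (lookup v 0F) (lookup v 1F)) →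
         Computable Z Nat f → Computable Z Nat g → Computable Z Nat (λ z → h (f z) (g z))
lift₂ᶜ {f = f} {g} h rh F G = liftᶜ {f = λ { 0F → f ; 1F → g }} rh λ { 0F → F ; 1F → G }

lift₃ᶜ : ∀ {Z f g k} (h : ℕ → ℕ → ℕ → ℕ) →
         Recursive {3} (λ v → h (lookup v 0F) (lookup v 1F) (lookup v 2F)) →
         Computable Z Nat f → Computable Z Nat g → Computable Z Nat k →
         Computable Z Nat (λ z → h (f z) (g z) (k z))
lift₃ᶜ {f = f} {g} {k} h rh F G K =
  liftᶜ {f = λ { 0F → f ; 1F → g ; 2F → k }} rh λ { 0F → F ; 1F → G ; 2F → K }

constᶜ : ∀ {Z} k → Computable Z Nat (λ _ → k)
constᶜ k = liftᶜ {n = 0} {f = λ ()} (natᵣ k) λ ()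

relationᵉ : ∀ {Z n} {R : Pred (Vec ℕ n) 0ℓ} {f : Fin n → Carrier ⟦ Z ⟧ → ℕ} → RecursiveRel R →
            (∀ i → Computable Z Nat (f i)) → Enumerable Z (λ z → R (tabulate λ i → f i z))
relationᵉ {R = R} {f} r F = Enumerable-resp (graphᵉ (liftᶜ {f = f} (χ-recursive r) F) (constᶜ 1))
  (λ z → χ⇔ (tabulate λ i → f i z))
  where
  χ⇔ : ∀ v → (χ r v ≡ 1) ⇔ R v
  χ⇔ v with χ r v | χ-spec r v
  ... | _ | inj₁ (Rv , refl)  = mk⇔ (λ _ → Rv) (λ _ → refl)
  ... | _ | inj₂ (¬Rv , refl) = mk⇔ (λ ()) (λ Rv → ⊥-elim (¬Rv Rv))

ballᵉ : ∀ {Z Y f s} → Computable Z Y f → Computable Z Nat s → Enumerable Z (λ z → InBall Y (s z) (f z))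
ballᵉ F S = preimages F ∘ᵉ (idᶜ ,ᶜ S)

-- Baire space

module _ {s : ℕ} {x : ℕ → ℕ} where
  private
    c m k : ℕ
    c = entry s 0
    m = entry s 1
    k = entry s 2

  -- Membership means agreement with the centre below some n₀ with 1 / (n₀ + 1) < m / (k + 1). The
  -- least such n₀ is the integer quotient of k + 1 by m, so the places that count are the n with m
  -- (n + 1) ≤ k + 1. For m ≥ 1 they all lie below k + 1, which bounds the quantifier.
  ω^ω-ball : InBall Seq s x ⇔
             (1 ℕ.≤ m × (∀ n → n ℕ.< suc k → m ℕ.* suc n ℕ.≤ suc k → x n ≡ entry c n))
  ω^ω-ball = mk⇔ (λ (inBall l) → ball⇒ l) (λ (1≤m , e) → inBall (⇒ball 1≤m e))
    where
    ball⇒ : N ω^ω s x → 1 ℕ.≤ m × (∀ n → n ℕ.< suc k → m ℕ.* suc n ℕ.≤ suc k → x n ≡ entry c n)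
    ball⇒ (n₀ , l , agree) = 1≤m , λ n _ le → agree n (ℕ.s<s⁻¹ (ℕ.*-cancelˡ-< m (suc n) (suc n₀) (ℕ.≤-<-trans le lt)))
      where
      lt : suc k ℕ.< m ℕ.* suc n₀
      lt = subst (ℕ._< m ℕ.* suc n₀) (ℕ.*-identityˡ (suc k)) (frac-<⁻¹ {1} {n₀} {m} {k} l)
      1≤m : 1 ℕ.≤ m
      1≤m = ℕ.n≢0⇒n>0 λ m≡0 → ℕ.n≮0 (subst (λ m → suc k ℕ.< m ℕ.* suc n₀) m≡0 lt)
    ⇒ball : 1 ℕ.≤ m → (∀ n → n ℕ.< suc k → m ℕ.* suc n ℕ.≤ suc k → x n ≡ entry c n) → N ω^ω s x
    ⇒ball 1≤m e = n₀
      , frac-< {1} {n₀} {m} {k} (subst (ℕ._< m ℕ.* suc n₀) (sym (ℕ.*-identityˡ (suc k))) 1+k<)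
      , λ n n<n₀ →
          let le = ℕ.≤-trans (ℕ.*-monoʳ-≤ m n<n₀) (ℕ.≤-trans (ℕ.≤-reflexive (ℕ.*-comm m n₀)) (m/n*n≤m (suc k) m))
          in e n (ℕ.≤-trans (ℕ.m≤n*m (suc n) m) le) le
      where
      instance
        m≢0 : ℕ.NonZero m
        m≢0 = ℕ.>-nonZero 1≤m
      n₀ : ℕ
      n₀ = suc k / m
      1+k< : suc k ℕ.< m ℕ.* suc n₀
      1+k< = subst₂ ℕ._<_ (sym (m≡m%n+[m/n]*n (suc k) m)) (ℕ.*-comm (suc n₀) m)
                    (ℕ.+-monoˡ-< (n₀ ℕ.* m) (m%n<n (suc k) m))

unit-ω^ω-ball : ∀ {w k x} → InBall Seq (ball w 1 k) x ⇔ (∀ n → n ℕ.< suc k → x n ≡ entry w n)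
unit-ω^ω-ball {w} {k} {x} = mk⇔
  (λ l n n<1+k → proj₂ (subst Agreement e (to (ω^ω-ball {ball w 1 k} {x}) l)) n n<1+k
                   (subst (ℕ._≤ suc k) (sym (ℕ.*-identityˡ (suc n))) n<1+k))
  (λ h → from (ω^ω-ball {ball w 1 k} {x}) (subst Agreement (sym e) (s≤s z≤n , λ n n<1+k _ → h n n<1+k)))
  where
  Agreement : Vec ℕ 3 → Set
  Agreement v = 1 ℕ.≤ lookup v 1F × (∀ n → n ℕ.< suc (lookup v 2F) →
    lookup v 1F ℕ.* suc n ℕ.≤ suc (lookup v 2F) → x n ≡ entry (lookup v 0F) n)
  e : entries (ball w 1 k) ≡ w ∷ 1 ∷ k ∷ []
  e = entries-encodeVec (w ∷ 1 ∷ k ∷ [])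

approximation : ∀ x k → InBall Seq (ball (encode x (suc k)) 1 k) x
approximation x k = from (unit-ω^ω-ball {encode x (suc k)} {k} {x}) λ n n<1+k → sym (entry-encode x (suc k) n n<1+k)

-- The value is read off a guessed finite approximation w of `f z`; the ball of radius 1 / (g z + 1)
-- about w forces agreement up to and including the place `g z`.
applyᶜ : ∀ {Z f g} → Computable Z Seq f → Computable Z Nat g → Computable Z Nat (λ z → f z (g z))
applyᶜ {f = f} {g} F G = fromGraph (Enumerable-resp
  (∃ᵉ (ballᵉ (F ∘ᶜ fstᶜ (fstᶜ idᶜ)) (lift₂ᶜ (λ w k → ball w 1 k) (ballᵣ p0 oneᵣ p1) (sndᶜ idᶜ) (G ∘ᶜ fstᶜ (fstᶜ idᶜ)))
       ∩ᵉ graphᵉ (lift₂ᶜ entry (entryᵣ p0 p1) (sndᶜ idᶜ) (G ∘ᶜ fstᶜ (fstᶜ idᶜ))) (sndᶜ (fstᶜ idᶜ))))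
  (λ (z , n) → mk⇔
    (λ (w , l , e) → trans (to (unit-ω^ω-ball {w} {g z} {f z}) l (g z) (ℕ.n<1+n (g z))) e)
    (λ e → encode (f z) (suc (g z)) , approximation (f z) (g z)
         , trans (entry-encode (f z) (suc (g z)) (g z) (ℕ.n<1+n (g z))) e)))

-- By `ω^ω-ball`, membership of `f z` in a ball is a bounded conjunction of decidable conditions on
-- the values `f z n`.
curryᶜ : ∀ {Z} {f : Carrier ⟦ Z ⟧ → ℕ → ℕ} → Computable (Z ⊠ Nat) Nat (λ (z , n) → f z n) → Computable Z Seq f
curryᶜ {Z} {f} F = computable (Enumerable-resp (positive ∩ᵉ (∀<ᵉ agreement ∘ᵉ (idᶜ ,ᶜ bound)))
  (λ (z , s) → mk⇔ (from (ω^ω-ball {s} {f z})) (to (ω^ω-ball {s} {f z}))))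
  where
  positive : Enumerable (Z ⊠ Nat) (λ (_ , s) → 1 ℕ.≤ entry s 1)
  positive = relationᵉ {n = 1} {R = λ v → 1 ℕ.≤ entry (lookup v 0F) 1} {f = λ { 0F → proj₂ }}
    (≤ᵣ oneᵣ (entryᵣ p0 oneᵣ)) (λ { 0F → sndᶜ idᶜ })
  bound : Computable (Z ⊠ Nat) Nat (λ (_ , s) → suc (entry s 2))
  bound = sequenceᶜ {h = λ s → suc (entry s 2)} (sᵣ (entryᵣ headᵣ (natᵣ 2))) (sndᶜ idᶜ)
  agreement : Enumerable ((Z ⊠ Nat) ⊠ Nat) λ ((z , s) , n) →
    entry s 1 ℕ.* suc n ℕ.≤ suc (entry s 2) → f z n ≡ entry (entry s 0) n
  agreement = relationᵉ {n = 3}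
    {R = λ v → entry (lookup v 0F) 1 ℕ.* suc (lookup v 1F) ℕ.≤ suc (entry (lookup v 0F) 2) →
               lookup v 2F ≡ entry (entry (lookup v 0F) 0) (lookup v 1F)}
    {f = λ { 0F ((_ , s) , _) → s ; 1F (_ , n) → n ; 2F ((z , _) , n) → f z n }}
    (→ᵣ (≤ᵣ (*ᵣ (entryᵣ p0 oneᵣ) (sᵣ p1)) (sᵣ (entryᵣ p0 (natᵣ 2))))
        (≡ᵣ p2 (entryᵣ (entryᵣ p0 zeroᵣ) p1)))
    (λ { 0F → sndᶜ (fstᶜ idᶜ) ; 1F → sndᶜ idᶜ ; 2F → F ∘ᶜ (fstᶜ (fstᶜ idᶜ) ,ᶜ sndᶜ idᶜ) })

sequence-constᶜ : ∀ {Z γ} → RecursiveSeq γ → Computable Z Seq (λ _ → γ)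
sequence-constᶜ rγ = curryᶜ (sequenceᶜ rγ (sndᶜ idᶜ))

ω^ω-ballᵣ : ∀ {n} {f g : Vec ℕ n → ℕ} → Recursive f → Recursive g →
            RecursiveRel (λ v → InBall Seq (f v) (RPPolish.r ω^ω (g v)))
ω^ω-ballᵣ {f = f} {g} rf rg = iffᵣ
  (substᵣ {h = λ { 0F → g ; 1F v → entry (f v) 0 ; 2F v → entry (f v) 1 ; 3F v → entry (f v) 2 }}
    (RPPolish.<-recursive ω^ω)
    (λ { 0F → rg ; 1F → entryᵣ rf zeroᵣ ; 2F → entryᵣ rf (natᵣ 1) ; 3F → entryᵣ rf (natᵣ 2) }))
  (λ _ → isInBall) (λ _ → inBall)

ω^ω-ball-resp : ∀ {s x y} → (∀ n → n ℕ.< suc (entry s 2) → x n ≡ y n) → InBall Seq s y → InBall Seq s x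
ω^ω-ball-resp {s} {x} {y} x≡y l =
  from (ω^ω-ball {s} {x}) (proj₁ (to (ω^ω-ball {s} {y}) l) ,
    λ n n< le → trans (x≡y n n<) (proj₂ (to (ω^ω-ball {s} {y}) l) n n< le))

rational-ballᵣ : RecursiveRel {2} (λ v → InBall Seq (lookup v 0F) (entry (lookup v 1F)))
rational-ballᵣ = ω^ω-ballᵣ p0 p1

flag-unique : ∀ {A : Set} {m n} → (A × m ≡ 1) ⊎ (¬ A × m ≡ 0) → (A × n ≡ 1) ⊎ (¬ A × n ≡ 0) → m ≡ n
flag-unique (inj₁ (_ , e)) (inj₁ (_ , e′)) = trans e (sym e′)
flag-unique (inj₁ (a , _)) (inj₂ (¬a , _)) = ⊥-elim (¬a a)
flag-unique (inj₂ (¬a , _)) (inj₁ (a , _)) = ⊥-elim (¬a a)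
flag-unique (inj₂ (_ , e)) (inj₂ (_ , e′)) = trans e (sym e′)

opaque
  -- Only the first `suc (entry s 2)` values of x matter. Cutting x off there yields a centre of the
  -- presentation, for which membership is decidable.
  test : ℕ → (ℕ → ℕ) → ℕ
  test s x = χ rational-ballᵣ (s ∷ encode x (suc (entry s 2)) ∷ [])

  -- Any w that agrees with x up to the radius of s can be tested in place of x.
  test-approximation : ∀ {s w x} → InBall Seq (ball w 1 (entry s 2)) x →
    (InBall Seq s x × χ rational-ballᵣ (s ∷ w ∷ []) ≡ 1) ⊎ (¬ InBall Seq s x × χ rational-ballᵣ (s ∷ w ∷ []) ≡ 0)
  test-approximation {s} {w} {x} l = decide (χ-spec rational-ballᵣ (s ∷ w ∷ []))
    where
    x≡w : ∀ n → n ℕ.< suc (entry s 2) → x n ≡ entry w n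
    x≡w = to (unit-ω^ω-ball {w} {entry s 2} {x}) l
    decide : ∀ {t} → (InBall Seq s (entry w) × t ≡ 1) ⊎ (¬ InBall Seq s (entry w) × t ≡ 0) →
             (InBall Seq s x × t ≡ 1) ⊎ (¬ InBall Seq s x × t ≡ 0)
    decide (inj₁ (l′ , e))  = inj₁ (ω^ω-ball-resp x≡w l′ , e)
    decide (inj₂ (¬l′ , e)) = inj₂ (¬l′ ∘ ω^ω-ball-resp (λ n n< → sym (x≡w n n<)) , e)

  test-spec : ∀ s x → (InBall Seq s x × test s x ≡ 1) ⊎ (¬ InBall Seq s x × test s x ≡ 0)
  test-spec s x = test-approximation {s} {encode x (suc (entry s 2))} (approximation x (entry s 2))

  testᶜ : ∀ {Z s f} → Computable Z Nat s → Computable Z Seq f → Computable Z Nat (λ z → test (s z) (f z))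
  testᶜ {s = s} {f} S F = fromGraph (Enumerable-resp
    (∃ᵉ (ballᵉ (F ∘ᶜ fstᶜ (fstᶜ idᶜ))
               (lift₂ᶜ (λ w s → ball w 1 (entry s 2)) (ballᵣ p0 oneᵣ (entryᵣ p1 (natᵣ 2)))
                       (sndᶜ idᶜ) (S ∘ᶜ fstᶜ (fstᶜ idᶜ)))
         ∩ᵉ graphᵉ (lift₂ᶜ (λ s w → χ rational-ballᵣ (s ∷ w ∷ [])) χᵣ (S ∘ᶜ fstᶜ (fstᶜ idᶜ)) (sndᶜ idᶜ))
                   (sndᶜ (fstᶜ idᶜ))))
    (λ (z , n) → mk⇔
      (λ (w , l , e) → trans (flag-unique (test-spec (s z) (f z)) (test-approximation l)) e)
      (λ e → encode (f z) (suc (entry (s z) 2)) , approximation (f z) (entry (s z) 2) , e)))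
    where
    χᵣ : Recursive {2} (λ v → χ rational-ballᵣ (lookup v 0F ∷ lookup v 1F ∷ []))
    χᵣ = compᵣ {h = λ { 0F v → lookup v 0F ; 1F v → lookup v 1F }} (χ-recursive rational-ballᵣ)
               (λ { 0F → p0 ; 1F → p1 }) (λ _ → refl)

  ω-test : ℕ → ℕ → ℕ
  ω-test s k = χ (ω-ballᵣ {2} p0 p1) (s ∷ k ∷ [])

  ω-test-spec : ∀ s k → (InBall Nat s k × ω-test s k ≡ 1) ⊎ (¬ InBall Nat s k × ω-test s k ≡ 0)
  ω-test-spec s k = χ-spec (ω-ballᵣ {2} p0 p1) (s ∷ k ∷ [])

  ω-testᶜ : ∀ {Z s k} → Computable Z Nat s → Computable Z Nat k → Computable Z Nat (λ z → ω-test (s z) (k z))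
  ω-testᶜ = lift₂ᶜ (λ s k → χ (ω-ballᵣ {2} p0 p1) (s ∷ k ∷ []))
    (compᵣ {h = λ { 0F v → lookup v 0F ; 1F v → lookup v 1F }} (χ-recursive (ω-ballᵣ {2} p0 p1))
           (λ { 0F → p0 ; 1F → p1 }) (λ _ → refl))

Computable⇔RecursiveMap : ∀ {Z Y f} → Computable Z Y f ⇔ RecursiveMap ⟦ Z ⟧ ⟦ Y ⟧ f
Computable⇔RecursiveMap {Z} {Y} {f} = mk⇔
  (λ F → to (Enumerable⇔Σ⁰₁ {Z ⊠ Nat}) (Enumerable-resp (preimages F) (λ _ → mk⇔ isInBall inBall)))
  (λ F → computable (Enumerable-resp (from (Enumerable⇔Σ⁰₁ {Z ⊠ Nat} {λ (z , k) → N ⟦ Y ⟧ k (f z)}) F)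
                                     (λ _ → mk⇔ inBall isInBall)))

-- The reduction

module Reduction (𝒢 : GoodParametrization) (X Y : RPPolish) where
  open GoodParametrization 𝒢
  open BorelCodes 𝒢

  record InG (Z : Space) (e : ℕ → ℕ) (z : Carrier ⟦ Z ⟧) : Set where
    constructor inG
    field
      isInG : G ⟦ Z ⟧ (e , z)

  open InG

  InG⇔G : ∀ A B {e z} → InG (⌊ A ⌋ ⊠ ⌊ B ⌋) e z ⇔ G (A ⊗ B) (e , z)
  InG⇔G A B = mk⇔ isInG inG

  opaque
    Gᵉ : ∀ Z → Enumerable (Seq ⊠ Z) (λ (e , z) → InG Z e z)
    Gᵉ Z = Enumerable-resp (from Enumerable⇔Σ⁰₁ (G-Σ ⟦ Z ⟧)) (λ _ → mk⇔ inG isInG)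

    index : ∀ {Z P} → Enumerable Z P → ∃ λ γ → RecursiveSeq γ × (∀ z → P z ⇔ InG Z γ z)
    index {Z} {P} E =
      let γ , rγ , P⊆G , G⊆P = to (Σ-sections ⟦ Z ⟧ P) (to Enumerable⇔Σ⁰₁ E)
      in γ , rγ , λ z → mk⇔ (λ p → inG (P⊆G p)) (λ (inG g) → G⊆P g)

  opaque
    section-index : ∀ Z W → TypeAtMost1 ⟦ Z ⟧ → ∃ λ S → Computable (Seq ⊠ Z) Seq S ×
                    (∀ e z w → InG (Z ⊠ W) e (z , w) ⇔ InG W (S (e , z)) w)
    section-index Z W type =
      let S , rS , S-spec = S-exists ⟦ Z ⟧ ⟦ W ⟧ type in
      S , from (Computable⇔RecursiveMap {Seq ⊠ Z} {Seq}) rS ,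
      λ e z w → mk⇔ (λ (inG g) → inG (to (S-spec e z w) g)) (λ (inG g) → inG (from (S-spec e z w) g))

  ⊠-type : ∀ A B → TypeAtMost1 ⟦ A ⟧ → TypeAtMost1 ⟦ B ⟧ → TypeAtMost1 ⟦ A ⊠ B ⟧
  ⊠-type A B = ⊗-type

  private
    E : Enumerable (Seq ⊠ ⌊ X ⌋ ⊠ Nat) (λ (e , z) → InG (⌊ X ⌋ ⊠ Nat) e z)
    E = Gᵉ (⌊ X ⌋ ⊠ Nat)

  opaque
    -- The X-side of the j-th ball of G if the other sides contain δ and k.
    slice : (ℕ → ℕ) → ℕ → ℕ → ℕ
    slice δ k j = select (test (left (code E j)) δ)
      (select (ω-test (right (right (code E j))) k) (left (right (code E j))))

    slice-spec : ∀ δ k j x → InBall ⌊ X ⌋ (slice δ k j) x ⇔ InBall (Seq ⊠ ⌊ X ⌋ ⊠ Nat) (code E j) (δ , x , k)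
    slice-spec δ k j x = mk⇔
      (λ l → let l₁ , l′ = to (gate (test-spec (left (code E j)) δ)) l
                 l₃ , l₂ = to (gate (ω-test-spec (right (right (code E j))) k)) l′
             in from split (l₁ , from split (l₂ , l₃)))
      (λ l → let l₁ , l′ = to split l
                 l₂ , l₃ = to split l′
             in from (gate (test-spec (left (code E j)) δ))
                  (l₁ , from (gate (ω-test-spec (right (right (code E j))) k)) (l₃ , l₂)))

    sliceᶜ : ∀ {Z δ k j} → Computable Z Seq δ → Computable Z Nat k → Computable Z Nat j →
             Computable Z Nat (λ z → slice (δ z) (k z) (j z))
    sliceᶜ Δ K J = lift₂ᶜ select (selectᵣ p0 p1)
      (testᶜ (sequenceᶜ {h = λ j → left (code E j)} (leftᵣ (codeᵣ E headᵣ)) J) Δ)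
      (lift₂ᶜ select (selectᵣ p0 p1)
        (ω-testᶜ (sequenceᶜ {h = λ j → right (right (code E j))} (rightᵣ (rightᵣ (codeᵣ E headᵣ))) J) K)
        (sequenceᶜ {h = λ j → left (right (code E j))} (leftᵣ (rightᵣ (codeᵣ E headᵣ))) J))

  -- The number p codes an index i into the open code γ and an index j of a ball of `G`. Rejected
  -- pairs give the empty ball, so the preimage is listed without an unbounded search.
  preimageBase : (ℕ → ℕ) → (ℕ → ℕ) → ℕ → ℕ
  preimageBase γ δ p = slice δ (γ (suc (entry p 0))) (entry p 1)

  preimageBase-spec : ∀ γ δ x → (∃ λ p → InBall ⌊ X ⌋ (preimageBase γ δ p) x) ⇔
                                (∃ λ i → InG (⌊ X ⌋ ⊠ Nat) δ (x , γ (suc i)))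
  preimageBase-spec γ δ x = mk⇔
    (λ (p , l) → entry p 0 , from (enumerates E _) (entry p 1 , to (slice-spec δ (γ (suc (entry p 0))) (entry p 1) x) l))
    (λ (i , g) →
      let j , l = to (enumerates E _) g in
      encodeVec (i ∷ j ∷ []) ,
      subst (λ v → InBall ⌊ X ⌋ (slice δ (γ (suc (lookup v 0F))) (lookup v 1F)) x)
            (sym (entries-encodeVec (i ∷ j ∷ []))) (from (slice-spec δ (γ (suc i)) j x) l))

  preimageBaseᶜ : ∀ {Z γ δ p} → Computable Z Seq γ → Computable Z Seq δ → Computable Z Nat p →
                  Computable Z Nat (λ z → preimageBase (γ z) (δ z) (p z))
  preimageBaseᶜ Γ Δ P =
    sliceᶜ Δ (applyᶜ Γ (sequenceᶜ {h = λ p → suc (entry p 0)} (sᵣ (entryᵣ headᵣ (natᵣ 0))) P))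
             (sequenceᶜ {h = λ p → entry p 1} (entryᵣ headᵣ (natᵣ 1)) P)

  -- The fixed point

  T : Space
  T = Seq ⊠ Seq ⊠ Seq

  private
    section-T : ∃ λ S → Computable (Seq ⊠ T) Seq S ×
                (∀ e z w → InG (T ⊠ Nat ⊠ Nat) e (z , w) ⇔ InG (Nat ⊠ Nat) (S (e , z)) w)
    section-T = section-index T (Nat ⊠ Nat) (⊠-type Seq (Seq ⊠ Seq) ω^ω-type (⊠-type Seq Seq ω^ω-type ω^ω-type))

  S : (ℕ → ℕ) × (ℕ → ℕ) × (ℕ → ℕ) × (ℕ → ℕ) → ℕ → ℕ
  S = proj₁ section-T

  Sᶜ : Computable (Seq ⊠ T) Seq S
  Sᶜ = proj₁ (proj₂ section-T)

  -- u with the index e of the function {u(γ , δ)*} still a parameter.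
  U : (ℕ → ℕ) × (ℕ → ℕ) × (ℕ → ℕ) → ℕ → ℕ
  U (e , γ , δ) n = branch n (γ 0) (branch (γ 0) (preimageBase γ δ (pred n)) (S (e , e , γ , δ) (pred n)))

  opaque
    Uᶜ : Computable T Seq U
    Uᶜ = curryᶜ (lift₃ᶜ branch (branchᵣ p0 p1 p2) n γ0
                  (lift₃ᶜ branch (branchᵣ p0 p1 p2) γ0
                    (preimageBaseᶜ γ δ n-1) (applyᶜ (Sᶜ ∘ᶜ (e ,ᶜ fstᶜ idᶜ)) n-1)))
      where
      n : Computable (T ⊠ Nat) Nat proj₂
      n = sndᶜ idᶜ
      n-1 : Computable (T ⊠ Nat) Nat (λ (_ , n) → pred n)
      n-1 = sequenceᶜ {h = pred} (predᵣ headᵣ) n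
      e : Computable (T ⊠ Nat) Seq (λ ((e , _) , _) → e)
      e = fstᶜ (fstᶜ idᶜ)
      γ : Computable (T ⊠ Nat) Seq (λ ((_ , γ , _) , _) → γ)
      γ = fstᶜ (sndᶜ (fstᶜ idᶜ))
      δ : Computable (T ⊠ Nat) Seq (λ ((_ , _ , δ) , _) → δ)
      δ = sndᶜ (sndᶜ (fstᶜ idᶜ))
      γ0 : Computable (T ⊠ Nat) Nat (λ ((_ , γ , _) , _) → γ 0)
      γ0 = applyᶜ γ (constᶜ 0)

  private
    cU : ℕ → ℕ
    cU = code (preimages Uᶜ)

    cUᵣ : ∀ {n} {f : Vec ℕ n → ℕ} → Recursive f → Recursive (λ v → cU (f v))
    cUᵣ = codeᵣ (preimages Uᶜ)

  split-T : ∀ {s e γ δ} → InBall T s (e , γ , δ) ⇔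
            (InBall Seq (left s) e × InBall Seq (left (right s)) γ × InBall Seq (right (right s)) δ)
  split-T = mk⇔ (λ l → let lₑ , l′ = to split l ; lγ , lδ = to split l′ in lₑ , lγ , lδ)
                (λ (lₑ , lγ , lδ) → from split (lₑ , from split (lγ , lδ)))

  -- The j-th ball witnesses U (e , α , δ) ∈ N k.  Of α only the balls containing it
  -- enter, so that α may be replaced by a value {γ*}(i) that need not be defined.
  Forces : (ℕ → ℕ) → (ℕ → Set) → (ℕ → ℕ) → ℕ → ℕ → Set
  Forces e α δ k j =
    InBall Nat (right (cU j)) k × InBall Seq (left (left (cU j))) e ×
    α (left (right (left (cU j)))) × InBall Seq (right (right (left (cU j)))) δ

  U-forced : ∀ e α δ k → InBall Seq k (U (e , α , δ)) ⇔ ∃ (Forces e (λ s → InBall Seq s α) δ k)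
  U-forced e α δ k = mk⇔
    (λ l → let j , l′  = to (enumerates (preimages Uᶜ) ((e , α , δ) , k)) l
               l₁ , lₖ = to (split {T} {Nat}) l′
           in j , lₖ , to split-T l₁)
    (λ (j , lₖ , l₁) →
       from (enumerates (preimages Uᶜ) ((e , α , δ) , k))
         (j , from (split {T} {Nat} {cU j} {e , α , δ} {k}) (from (split-T {left (cU j)} {e} {α} {δ}) l₁ , lₖ)))

  Q : Pred (Carrier ⟦ T ⊠ Nat ⊠ Nat ⟧) 0ℓ
  Q ((e , γ , δ) , i , k) = ∃ (Forces e (λ s → InG (Nat ⊠ Nat) (γ *) (i , s)) δ k)

  opaque
    Qᵉ : Enumerable (T ⊠ Nat ⊠ Nat) Q
    Qᵉ = ∃ᵉ (ballᵉ k (sequenceᶜ {h = λ j → right (cU j)} (rightᵣ (cUᵣ headᵣ)) j)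
             ∩ᵉ (ballᵉ e (sequenceᶜ {h = λ j → left (left (cU j))} (leftᵣ (leftᵣ (cUᵣ headᵣ))) j)
             ∩ᵉ ((Gᵉ (Nat ⊠ Nat) ∘ᵉ
                   (γ* ,ᶜ i ,ᶜ sequenceᶜ {h = λ j → left (right (left (cU j)))} (leftᵣ (rightᵣ (leftᵣ (cUᵣ headᵣ)))) j))
             ∩ᵉ ballᵉ δ (sequenceᶜ {h = λ j → right (right (left (cU j)))} (rightᵣ (rightᵣ (leftᵣ (cUᵣ headᵣ)))) j))))
      where
      Z : Space
      Z = (T ⊠ Nat ⊠ Nat) ⊠ Nat
      j : Computable Z Nat proj₂
      j = sndᶜ idᶜ
      k : Computable Z Nat (λ ((_ , _ , k) , _) → k)
      k = sndᶜ (sndᶜ (fstᶜ idᶜ))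
      i : Computable Z Nat (λ ((_ , i , _) , _) → i)
      i = fstᶜ (sndᶜ (fstᶜ idᶜ))
      e : Computable Z Seq (λ (((e , _) , _) , _) → e)
      e = fstᶜ (fstᶜ (fstᶜ idᶜ))
      γ : Computable Z Seq (λ (((_ , γ , _) , _) , _) → γ)
      γ = fstᶜ (sndᶜ (fstᶜ (fstᶜ idᶜ)))
      γ* : Computable Z Seq (λ (((_ , γ , _) , _) , _) → γ *)
      γ* = curryᶜ (applyᶜ (γ ∘ᶜ fstᶜ idᶜ) (sequenceᶜ {h = suc} (sᵣ headᵣ) (sndᶜ idᶜ)))
      δ : Computable Z Seq (λ (((_ , _ , δ) , _) , _) → δ)
      δ = sndᶜ (sndᶜ (fstᶜ (fstᶜ idᶜ)))

  private
    index-Q : ∃ λ e → RecursiveSeq e × (∀ z → Q z ⇔ InG (T ⊠ Nat ⊠ Nat) e z)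
    index-Q = index Qᵉ

  -- The fixed point: ê indexes the set Q defined from U (ê , _ , _).
  ê : ℕ → ℕ
  ê = proj₁ index-Q

  -- Here the circle closes: `ê` is both the index whose section is taken and the first entry of the
  -- triple at which it is taken. The section therefore describes `Q` at `ê`, which is defined from
  -- u itself.
  S-ê : ∀ γ δ i k → InG (Nat ⊠ Nat) (S (ê , ê , γ , δ)) (i , k) ⇔ Q ((ê , γ , δ) , i , k)
  S-ê γ δ i k = mk⇔
    (λ g → from (proj₂ (proj₂ index-Q) ((ê , γ , δ) , i , k)) (from (proj₂ (proj₂ section-T) ê (ê , γ , δ) (i , k)) g))
    (λ q → to (proj₂ (proj₂ section-T) ê (ê , γ , δ) (i , k)) (to (proj₂ (proj₂ index-Q) ((ê , γ , δ) , i , k)) q))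

  -- The map u and its action on Borel codes

  u : (ℕ → ℕ) × (ℕ → ℕ) → ℕ → ℕ
  u (γ , δ) = U (ê , γ , δ)

  uᶜ : Computable (Seq ⊠ Seq) Seq u
  uᶜ = Uᶜ ∘ᶜ (sequence-constᶜ (proj₁ (proj₂ index-Q)) ,ᶜ fstᶜ idᶜ ,ᶜ sndᶜ idᶜ)

  -- `G` is given only as a predicate on functions, but it is a union of balls, and a ball of ω^ω
  -- sees finitely many values. Pointwise equations between codes can therefore be used inside `G`.
  InG-resp : ∀ {Z γ γ′ z} → (∀ n → γ n ≡ γ′ n) → InG Z γ z → InG Z γ′ z
  InG-resp {Z} {γ} {γ′} {z} γ≡γ′ g =
    let i , l   = to (enumerates (Gᵉ Z) (γ , z)) g
        l₁ , l₂ = to split l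
    in from (enumerates (Gᵉ Z) (γ′ , z)) (i , from split (ω^ω-ball-resp (λ n _ → sym (γ≡γ′ n)) l₁ , l₂))

  u-tail : ∀ {γ} δ → γ 0 ≡ 1 → ∀ n → (u (γ , δ) *) n ≡ S (ê , ê , γ , δ) n
  u-tail {γ} δ γ0≡1 n = cong (λ w → branch w (preimageBase γ δ n) (S (ê , ê , γ , δ) n)) γ0≡1

  -- `value` exchanges the balls that contain α for the condition on `G` in `Q`, so that the index
  -- in the tail of u(γ,δ) computes u({γ*}(i), δ) at i whenever {γ*}(i) is defined.
  u-value : ∀ {γ} δ {i α} → γ 0 ≡ 1 → Value ω ω^ω (γ *) i α → ∀ k →
            InBall Seq k (u (α , δ)) ⇔ InG (Nat ⊠ Nat) (u (γ , δ) *) (i , k)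
  u-value {γ} δ {i} {α} γ0≡1 value k = mk⇔
    (λ l → let j , lₖ , lₑ , lα , lδ = to (U-forced ê α δ k) l in
       InG-resp (λ n → sym (u-tail δ γ0≡1 n))
         (from (S-ê γ δ i k) (j , lₖ , lₑ , from (InG⇔G ω ω) (to (value _) (isInBall lα)) , lδ)))
    (λ g → let j , lₖ , lₑ , g′ , lδ = to (S-ê γ δ i k) (InG-resp (u-tail δ γ0≡1) g) in
       from (U-forced ê α δ k) (j , lₖ , lₑ , inBall (from (value _) (to (InG⇔G ω ω) g′)) , lδ))

  u-BC : ∀ {ξ γ} δ → BC ξ γ → BC ξ (u (γ , δ))
  -- The entry at 0 of u(γ,δ) reduces to γ 0, so the same proof serves; in the next clause the ranks
  -- η are likewise kept, and hence ξ.
  u-BC δ (base ξ≈1 γ0≡0) = base ξ≈1 γ0≡0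
  u-BC δ (step 2≤ξ γ0≡1 α values η bounds b) =
    step 2≤ξ γ0≡1 (λ i → u (α i , δ))
      (λ i k → mk⇔ (λ l → to (InG⇔G ω ω) (to (u-value δ γ0≡1 (values i) k) (inBall l)))
                   (λ g → isInBall (from (u-value δ γ0≡1 (values i) k) (from (InG⇔G ω ω) g))))
      η bounds (λ i → u-BC δ (b i))

  -- The derivations b and b′ need not choose the same functions as values, hence the
  -- statement up to pointwise equality.
  ρ-u : ∀ {ξ ξ′ γ γ′} δ (b : BC ξ γ) (b′ : BC ξ′ γ′) → (∀ n → γ′ n ≡ u (γ , δ) n) →
        ∀ x y → Value X Y δ x y → ρξ X b′ x ⇔ ρξ Y b y
  ρ-u {γ = γ} {γ′} δ (base _ γ0≡0) (base _ _) γ′≡u x y value = mk⇔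
    (λ (p , l) → let i , g = to (preimageBase-spec γ δ x)
                               (p , subst (λ s → InBall ⌊ X ⌋ s x) (tail-u p) (inBall l)) in
       i , from (value (γ (suc i))) (to (InG⇔G X ω) g))
    (λ (i , l) → let p , l′ = from (preimageBase-spec γ δ x)
                               (i , from (InG⇔G X ω) (to (value (γ (suc i))) l)) in
       p , isInBall (subst (λ s → InBall ⌊ X ⌋ s x) (sym (tail-u p)) l′))
    where
    tail-u : ∀ p → γ′ (suc p) ≡ preimageBase γ δ p
    tail-u p = trans (γ′≡u (suc p))
      (cong (λ w → branch w (preimageBase γ δ p) (S (ê , ê , γ , δ) p)) γ0≡0)
  ρ-u δ (base _ γ0≡0) (step _ γ′0≡1 _ _ _ _ _) γ′≡u x y value =
    contradiction (trans (sym γ′0≡1) (trans (γ′≡u 0) γ0≡0)) λ ()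
  ρ-u δ (step _ γ0≡1 _ _ _ _ _) (base _ γ′0≡0) γ′≡u x y value =
    contradiction (trans (sym γ′0≡0) (trans (γ′≡u 0) γ0≡1)) λ ()
  ρ-u {γ = γ} {γ′} δ (step _ γ0≡1 α values _ _ b) (step _ _ α′ values′ _ _ b′) γ′≡u x y value = mk⇔
    (λ (i , ¬ρ) → i , ¬ρ ∘ from (IH i))
    (λ (i , ¬ρ) → i , ¬ρ ∘ to (IH i))
    where
    α′≡u : ∀ i n → α′ i n ≡ u (α i , δ) n
    -- Both sequences are values at i of the function indexed by the tail of γ′, and balls separate
    -- points.
    α′≡u i = N-separates ω^ω (α′ i) (u (α i , δ)) λ k l →
      isInBall (from (u-value δ γ0≡1 (values i) k)
        (InG-resp (λ n → γ′≡u (suc n)) (from (InG⇔G ω ω) (to (values′ i k) l))))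
    IH : ∀ i → ρξ X (b′ i) x ⇔ ρξ Y (b i) y
    IH i = ρ-u δ (b i) (b′ i) (α′≡u i) x y value

lemma3p3 : (𝒢 : GoodParametrization) (X Y : RPPolish) →
    let open BorelCodes 𝒢
        open RPPolish ω^ω using () renaming (Carrier to Baire) in
    ∃ λ (u : Baire × Baire → Baire) →
      RecursiveMap (ω^ω ⊗ ω^ω) ω^ω u ×
      (∀ (ξ : Ord) → 1ₒ ≤ₒ ξ → ∀ (γ : Baire) → BC ξ γ → ∀ (δ : Baire) →
        BC ξ (u (γ , δ))) ×
      (∀ (γ δ : Baire) (b : BC∪ γ) (b′ : BC∪ (u (γ , δ))) (x : RPPolish.Carrier X) →
        (D : Defined X Y δ x) →
        ρ X b′ x ⇔ ρ Y b (proj₁ D))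
lemma3p3 𝒢 X Y =
    u
  , to (Computable⇔RecursiveMap {Seq ⊠ Seq} {Seq}) uᶜ
  , (λ ξ _ γ b δ → u-BC δ b)
  , λ { γ δ (_ , _ , b) (_ , _ , b′) x (y , value) → ρ-u δ b b′ (λ _ → refl) x y value }
  where
  open Reduction 𝒢 X Y
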